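{- There exists an infinite family of (pairwise non-isomorphic) finite simple connected $5$-regular Ricci-flat graphs, each of which is neither isomorphic to the $72$-vertex graph $RF^5_{72}$ nor of Cartesian product type.
   Context: All graphs are finite, simple, connected and unweighted; $d(u,v)$ is the shortest-path distance, $N(x)$ the neighborhood of $x$, and $d_x=|N(x)|$. For a vertex $x$ and $\alpha\in[0,1]$, let $\mu_x^\alpha$ be the probability measure on $V$ with $\mu_x^\alpha(x)=\alpha$, $\mu_x^\alpha(z)=(1-\alpha)/d_x$ for $z\in N(x)$, and $\mu_x^\alpha(z)=0$ otherwise. For probability measures $\mu,\nu$ on $V$, $W_1(\mu,\nu)=\min_\pi\sum_{u,v\in V}d(u,v)\pi(u,v)$, where the minimum is over all $\pi:V\times V\to[0,1]$ with marginals $\mu$ and $\nu$. For an edge $xy$, set $\kappa_\alpha(x,y)=1-W_1(\mu_x^\alpha,\mu_y^\alpha)$, and define the Lin--Lu--Yau curvature by $\kappa(x,y)=\lim_{\alpha\to1^- }\kappa_\alpha(x,y)/(1-\alpha)$ (this limit exists). A graph $G$ is Ricci-flat if $\kappa(x,y)=0$ for every edge $xy\in E(G)$. A graph is symmetric if its automorphism group acts transitively on both its vertex set and its edge set. $RF^5_{72}$ denotes the $5$-regular symmetric Ricci-flat graph constructed by Lei and Bai; it has $72$ vertices, and by their theorem it is the unique $5$-regular symmetric Ricci-flat graph up to isomorphism. The Cartesian product $X\square Y$ has vertex set $V(X)\times V(Y)$, with $(u,x)$ and $(v,y)$ adjacent iff either $u=v$ and $xy\in E(Y)$, or $x=y$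 and $uv\in E(X)$. A graph is of Cartesian product type if it is isomorphic to $X\square Y$ for some finite simple graphs $X,Y$ each having at least two vertices. -}

module Defs where

open import Data.Bool.Base using (if_then_else_)
open import Data.Fin.Base using (Fin)
import Data.Fin.Properties as Fin
open import Data.List.Base using (List; tabulate; filter; length; foldr)
open import Data.Nat.Base as ℕ using (ℕ; zero; suc; z≤n; s≤s)
import Data.Nat.Properties as ℕ
import Data.Integer.Base as ℤ
open import Data.Product.Base using (Σ; ∃; ∃₂; _×_; _,_; proj₁; proj₂)
open import Data.Product.Function.NonDependent.Propositional using (_×-↔_)
open import Data.Rational.Base as ℚ using (ℚ; 0ℚ; 1ℚ)
import Data.Rational.Properties as ℚ
open import Data.Rational.Solver using (module +-*-Solver)
open import Data.Sum.Base using (_⊎_; inj₁; inj₂)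
open import Function.Base using (_∘_)
open import Function.Bundles using (_↔_; _⇔_; Inverse)
open import Function.Properties.Inverse using (↔⇒↣; ↔-sym; ↔-trans)
open import Relation.Binary.Definitions using (Decidable; Symmetric)
open import Relation.Binary.PropositionalEquality
open import Relation.Nullary using (¬_; Dec; yes; no; does; contradiction)
open import Relation.Nullary.Decidable using (map′; via-injection; _×-dec_; _⊎-dec_)
open import Relation.Unary using () renaming (Decidable to Decidable₁)

------------------------------------------------------------------------
-- Cauchy real numbers.  All operations act termwise.

module Real where

  IsCauchy : (ℕ → ℚ) → Set
  IsCauchy s = ∀ ε → 0ℚ ℚ.< ε → ∃ λ N → ∀ m n → N ℕ.≤ m → N ℕ.≤ n →
               ℚ.∣ s m ℚ.- s n ∣ ℚ.≤ ε

  record ℝ : Set where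
    constructor mkℝ
    field
      seq    : ℕ → ℚ
      cauchy : IsCauchy seq
  open ℝ public

  infix 4 _≈_ _≤_ _<_

  record _≤_ (x y : ℝ) : Set where
    constructor mk≤
    field
      eventually : ∀ ε → 0ℚ ℚ.< ε → ∃ λ N → ∀ n → N ℕ.≤ n →
                   seq x n ℚ.≤ seq y n ℚ.+ ε

  record _<_ (x y : ℝ) : Set where
    constructor mk<
    field
      gap        : ℚ
      0<gap      : 0ℚ ℚ.< gap
      start      : ℕ
      eventually : ∀ n → start ℕ.≤ n → seq x n ℚ.+ gap ℚ.≤ seq y n

  -- Equality of the represented real numbers.
  _≈_ : ℝ → ℝ → Set
  x ≈ y = x ≤ y × y ≤ x

  private
    module Identities where
      open +-*-Solver
      abstract
        +-swap : ∀ a b c d → (a ℚ.+ b) ℚ.- (c ℚ.+ d) ≡ (a ℚ.- c) ℚ.+ (b ℚ.- d)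
        +-swap = solve 4 (λ a b c d → (a :+ b) :- (c :+ d) := (a :- c) :+ (b :- d)) refl

        sub-add : ∀ a b → a ≡ (a ℚ.- b) ℚ.+ b
        sub-add = solve 2 (λ a b → a := (a :- b) :+ b) refl

        add-sub : ∀ c a → 0ℚ ℚ.+ c ≡ (a ℚ.+ c) ℚ.- a
        add-sub = solve 2 (λ c a → con 0ℚ :+ c := (a :+ c) :- a) refl

        neg-sub : ∀ a b → ℚ.- (a ℚ.- b) ≡ b ℚ.- a
        neg-sub = solve 2 (λ a b → :- (a :- b) := b :- a) refl

        *-diff : ∀ a b c d → a ℚ.* b ℚ.- c ℚ.* d ≡ a ℚ.* (b ℚ.- d) ℚ.+ d ℚ.* (a ℚ.- c)
        *-diff = solve 4 (λ a b c d → a :* b :- c :* d := a :* (b :- d) :+ d :* (a :- c)) refl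

        *-rotate : ∀ d e i → d ℚ.* (e ℚ.* i) ≡ e ℚ.* (d ℚ.* i)
        *-rotate = solve 3 (λ d e i → d :* (e :* i) := e :* (d :* i)) refl

        *-swap : ∀ i a j → i ℚ.* (a ℚ.* j) ≡ a ℚ.* i ℚ.* j
        *-swap = solve 3 (λ i a j → i :* (a :* j) := a :* i :* j) refl

        inv-diff : ∀ u v b d → u ℚ.* v ℚ.* (b ℚ.- d) ≡ b ℚ.* u ℚ.* v ℚ.- d ℚ.* v ℚ.* u
        inv-diff = solve 4 (λ u v b d → u :* v :* (b :- d) := b :* u :* v :- d :* v :* u) refl

        *-collect : ∀ u e w → u ℚ.* u ℚ.* (e ℚ.* (w ℚ.* w)) ≡ e ℚ.* (w ℚ.* u ℚ.* (w ℚ.* u))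
        *-collect = solve 3 (λ u e w → u :* u :* (e :* (w :* w)) := e :* (w :* u :* (w :* u))) refl

  private
    module Proofs where
      abstract
        half-pos : ∀ {ε} → 0ℚ ℚ.< ε → 0ℚ ℚ.< ε ℚ.* ℚ.½
        half-pos {ε} p = subst (ℚ._< ε ℚ.* ℚ.½) (ℚ.*-zeroˡ ℚ.½)
                               (ℚ.*-monoˡ-<-pos ℚ.½ p)

        half+half : ∀ ε → ε ℚ.* ℚ.½ ℚ.+ ε ℚ.* ℚ.½ ≡ ε
        half+half ε = trans (sym (ℚ.*-distribˡ-+ ε ℚ.½ ℚ.½)) (ℚ.*-identityʳ ε)

        const-cauchy : ∀ q → IsCauchy (λ _ → q)
        const-cauchy q ε 0<ε = 0 , λ _ _ _ _ →
          subst (ℚ._≤ ε) (cong ℚ.∣_∣ (sym (ℚ.+-inverseʳ q))) (ℚ.<⇒≤ 0<ε)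

        +-cauchy : ∀ {s t} → IsCauchy s → IsCauchy t → IsCauchy (λ n → s n ℚ.+ t n)
        +-cauchy {s} {t} cs ct ε 0<ε
          with M , hs ← cs (ε ℚ.* ℚ.½) (half-pos 0<ε)
             | N , ht ← ct (ε ℚ.* ℚ.½) (half-pos 0<ε)
          = M ℕ.⊔ N , λ m n p q → begin
            ℚ.∣ (s m ℚ.+ t m) ℚ.- (s n ℚ.+ t n) ∣
              ≡⟨ cong ℚ.∣_∣ (Identities.+-swap (s m) (t m) (s n) (t n)) ⟩
            ℚ.∣ (s m ℚ.- s n) ℚ.+ (t m ℚ.- t n) ∣
              ≤⟨ ℚ.∣p+q∣≤∣p∣+∣q∣ (s m ℚ.- s n) (t m ℚ.- t n) ⟩
            ℚ.∣ s m ℚ.- s n ∣ ℚ.+ ℚ.∣ t m ℚ.- t n ∣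
              ≤⟨ ℚ.+-mono-≤ (hs m n (ℕ.m⊔n≤o⇒m≤o M N p) (ℕ.m⊔n≤o⇒m≤o M N q))
                            (ht m n (ℕ.m⊔n≤o⇒n≤o M N p) (ℕ.m⊔n≤o⇒n≤o M N q)) ⟩
            ε ℚ.* ℚ.½ ℚ.+ ε ℚ.* ℚ.½
              ≡⟨ half+half ε ⟩
            ε ∎
          where open ℚ.≤-Reasoning

        neg-cauchy : ∀ {s} → IsCauchy s → IsCauchy (λ n → ℚ.- s n)
        neg-cauchy {s} cs ε 0<ε with N , h ← cs ε 0<ε = N , λ m n p q →
          subst (ℚ._≤ ε)
            (trans (sym (ℚ.∣-p∣≡∣p∣ (s m ℚ.- s n)))
                   (cong ℚ.∣_∣ (ℚ.neg-distrib-+ (s m) (ℚ.- s n))))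
            (h m n p q)

        bounded : ∀ {s} → IsCauchy s → ∃₂ λ B N → 0ℚ ℚ.< B ×
                  (∀ n → N ℕ.≤ n → ℚ.∣ s n ∣ ℚ.≤ B)
        bounded {s} cs with N , h ← cs 1ℚ (ℚ.positive⁻¹ 1ℚ) =
          1ℚ ℚ.+ ℚ.∣ s N ∣ , N ,
          ℚ.+-mono-<-≤ {0ℚ} {1ℚ} {0ℚ} (ℚ.positive⁻¹ 1ℚ) (ℚ.0≤∣p∣ (s N)) ,
          λ n p → begin
            ℚ.∣ s n ∣
              ≡⟨ cong ℚ.∣_∣ (Identities.sub-add (s n) (s N)) ⟩
            ℚ.∣ (s n ℚ.- s N) ℚ.+ s N ∣
              ≤⟨ ℚ.∣p+q∣≤∣p∣+∣q∣ (s n ℚ.- s N) (s N) ⟩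
            ℚ.∣ s n ℚ.- s N ∣ ℚ.+ ℚ.∣ s N ∣
              ≤⟨ ℚ.+-monoˡ-≤ ℚ.∣ s N ∣ (h n N p ℕ.≤-refl) ⟩
            1ℚ ℚ.+ ℚ.∣ s N ∣ ∎
          where open ℚ.≤-Reasoning

        *-pos : ∀ {p q} → 0ℚ ℚ.< p → 0ℚ ℚ.< q → 0ℚ ℚ.< p ℚ.* q
        *-pos {p} {q} 0<p 0<q = subst (ℚ._< p ℚ.* q) (ℚ.*-zeroˡ q)
          (ℚ.*-monoˡ-<-pos q {{ℚ.positive 0<q}} 0<p)

        *-mono-≤ : ∀ {p q r s} → 0ℚ ℚ.≤ r → 0ℚ ℚ.≤ q → p ℚ.≤ q → r ℚ.≤ s →
                   p ℚ.* r ℚ.≤ q ℚ.* s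
        *-mono-≤ {p} {q} {r} {s} 0≤r 0≤q p≤q r≤s = ℚ.≤-trans
          (ℚ.*-monoʳ-≤-nonNeg r {{ℚ.nonNegative 0≤r}} p≤q)
          (ℚ.*-monoˡ-≤-nonNeg q {{ℚ.nonNegative 0≤q}} r≤s)

        *-close : ∀ a b c d B C δ → 0ℚ ℚ.< B → 0ℚ ℚ.< C →
                  ℚ.∣ a ∣ ℚ.≤ B → ℚ.∣ d ∣ ℚ.≤ C →
                  ℚ.∣ a ℚ.- c ∣ ℚ.≤ δ → ℚ.∣ b ℚ.- d ∣ ℚ.≤ δ →
                  ℚ.∣ a ℚ.* b ℚ.- c ℚ.* d ∣ ℚ.≤ (B ℚ.+ C) ℚ.* δ
        *-close a b c d B C δ 0<B 0<C a≤B d≤C ac bd = begin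
          ℚ.∣ a ℚ.* b ℚ.- c ℚ.* d ∣
            ≡⟨ cong ℚ.∣_∣ (Identities.*-diff a b c d) ⟩
          ℚ.∣ a ℚ.* (b ℚ.- d) ℚ.+ d ℚ.* (a ℚ.- c) ∣
            ≤⟨ ℚ.∣p+q∣≤∣p∣+∣q∣ (a ℚ.* (b ℚ.- d)) (d ℚ.* (a ℚ.- c)) ⟩
          ℚ.∣ a ℚ.* (b ℚ.- d) ∣ ℚ.+ ℚ.∣ d ℚ.* (a ℚ.- c) ∣
            ≡⟨ cong₂ ℚ._+_ (ℚ.∣p*q∣≡∣p∣*∣q∣ a (b ℚ.- d)) (ℚ.∣p*q∣≡∣p∣*∣q∣ d (a ℚ.- c)) ⟩
          ℚ.∣ a ∣ ℚ.* ℚ.∣ b ℚ.- d ∣ ℚ.+ ℚ.∣ d ∣ ℚ.* ℚ.∣ a ℚ.- c ∣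
            ≤⟨ ℚ.+-mono-≤
                 (*-mono-≤ {ℚ.∣ a ∣} {B} {ℚ.∣ b ℚ.- d ∣} {δ}
                   (ℚ.0≤∣p∣ (b ℚ.- d)) (ℚ.<⇒≤ {0ℚ} {B} 0<B) a≤B bd)
                 (*-mono-≤ {ℚ.∣ d ∣} {C} {ℚ.∣ a ℚ.- c ∣} {δ}
                   (ℚ.0≤∣p∣ (a ℚ.- c)) (ℚ.<⇒≤ {0ℚ} {C} 0<C) d≤C ac) ⟩
          B ℚ.* δ ℚ.+ C ℚ.* δ
            ≡⟨ sym (ℚ.*-distribʳ-+ δ B C) ⟩
          (B ℚ.+ C) ℚ.* δ ∎
          where open ℚ.≤-Reasoning

        divide : ∀ D ε → 0ℚ ℚ.< D → 0ℚ ℚ.< ε → ∃ λ δ → 0ℚ ℚ.< δ × D ℚ.* δ ≡ ε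
        divide D ε 0<D 0<ε =
          ε ℚ.* j ,
          *-pos {ε} {j} 0<ε (ℚ.positive⁻¹ j {{ℚ.1/pos⇒pos D {{ℚ.positive {D} 0<D}}}}) ,
          trans (Identities.*-rotate D ε j)
            (trans (cong (ε ℚ.*_) (ℚ.*-inverseʳ D {{ℚ.pos⇒nonZero D {{ℚ.positive {D} 0<D}}}}))
              (ℚ.*-identityʳ ε))
          where
          j : ℚ
          j = ℚ.1/_ D {{ℚ.pos⇒nonZero D {{ℚ.positive {D} 0<D}}}}

        *-cauchy : ∀ {s t} → IsCauchy s → IsCauchy t → IsCauchy (λ n → s n ℚ.* t n)
        *-cauchy {s} {t} cs ct ε 0<ε
          with B , K , 0<B , hB ← bounded {s} cs
             | C , L , 0<C , hC ← bounded {t} ct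
          with δ , 0<δ , Dδ ← divide (B ℚ.+ C) ε (ℚ.+-mono-< {0ℚ} {B} {0ℚ} {C} 0<B 0<C) 0<ε
          with M , hs ← cs δ 0<δ
             | N , ht ← ct δ 0<δ
          = (K ℕ.⊔ L) ℕ.⊔ (M ℕ.⊔ N) , λ m n p q →
            let p₁ = ℕ.m⊔n≤o⇒m≤o (K ℕ.⊔ L) (M ℕ.⊔ N) p
                q₁ = ℕ.m⊔n≤o⇒m≤o (K ℕ.⊔ L) (M ℕ.⊔ N) q
                p₂ = ℕ.m⊔n≤o⇒n≤o (K ℕ.⊔ L) (M ℕ.⊔ N) p
                q₂ = ℕ.m⊔n≤o⇒n≤o (K ℕ.⊔ L) (M ℕ.⊔ N) q
            in subst (ℚ.∣ s m ℚ.* t m ℚ.- s n ℚ.* t n ∣ ℚ.≤_) Dδ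
                 (*-close (s m) (t m) (s n) (t n) B C δ 0<B 0<C
                   (hB m (ℕ.m⊔n≤o⇒m≤o K L p₁)) (hC n (ℕ.m⊔n≤o⇒n≤o K L q₁))
                   (hs m n (ℕ.m⊔n≤o⇒m≤o M N p₂) (ℕ.m⊔n≤o⇒m≤o M N q₂))
                   (ht m n (ℕ.m⊔n≤o⇒n≤o M N p₂) (ℕ.m⊔n≤o⇒n≤o M N q₂)))

  infixl 6 _+_ _-_
  infixl 7 _*_
  infix  8 -_

  fromℚ : ℚ → ℝ
  fromℚ q = mkℝ (λ _ → q) (Proofs.const-cauchy q)

  fromℕ : ℕ → ℝ
  fromℕ n = fromℚ (ℤ.+ n ℚ./ 1)

  0ℝ 1ℝ : ℝ
  0ℝ = fromℚ 0ℚ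
  1ℝ = fromℚ 1ℚ

  _+_ : ℝ → ℝ → ℝ
  x + y = mkℝ (λ n → seq x n ℚ.+ seq y n) (Proofs.+-cauchy {seq x} {seq y} (cauchy x) (cauchy y))

  -_ : ℝ → ℝ
  - x = mkℝ (λ n → ℚ.- seq x n) (Proofs.neg-cauchy {seq x} (cauchy x))

  _-_ : ℝ → ℝ → ℝ
  x - y = x + - y

  _*_ : ℝ → ℝ → ℝ
  x * y = mkℝ (λ n → seq x n ℚ.* seq y n) (Proofs.*-cauchy {seq x} {seq y} (cauchy x) (cauchy y))

  private
    module Inverses where
      abstract
        recip-anti : ∀ c j a i → c ℚ.* j ≡ 1ℚ → 0ℚ ℚ.< j → a ℚ.* i ≡ 1ℚ → 0ℚ ℚ.< i →
                     c ℚ.≤ a → i ℚ.≤ j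
        recip-anti c j a i cj 0<j ai 0<i c≤a = begin
          i                 ≡⟨ sym (ℚ.*-identityʳ i) ⟩
          i ℚ.* 1ℚ          ≡⟨ cong (i ℚ.*_) (sym cj) ⟩
          i ℚ.* (c ℚ.* j)   ≤⟨ ℚ.*-monoˡ-≤-nonNeg i {{ℚ.nonNegative {i} (ℚ.<⇒≤ {0ℚ} {i} 0<i)}}
                                 {c ℚ.* j} {a ℚ.* j}
                                 (ℚ.*-monoʳ-≤-nonNeg j {{ℚ.nonNegative {j} (ℚ.<⇒≤ {0ℚ} {j} 0<j)}}
                                   {c} {a} c≤a) ⟩
          i ℚ.* (a ℚ.* j)   ≡⟨ Identities.*-swap i a j ⟩
          a ℚ.* i ℚ.* j     ≡⟨ cong (ℚ._* j) ai ⟩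
          1ℚ ℚ.* j          ≡⟨ ℚ.*-identityˡ j ⟩
          j ∎
          where open ℚ.≤-Reasoning

        recip-diff : ∀ a i b k → a ℚ.* i ≡ 1ℚ → b ℚ.* k ≡ 1ℚ →
                     i ℚ.- k ≡ k ℚ.* i ℚ.* (b ℚ.- a)
        recip-diff a i b k ai bk = sym (begin
          k ℚ.* i ℚ.* (b ℚ.- a)
            ≡⟨ Identities.inv-diff k i b a ⟩
          b ℚ.* k ℚ.* i ℚ.- a ℚ.* i ℚ.* k
            ≡⟨ cong₂ (λ u v → u ℚ.* i ℚ.- v ℚ.* k) bk ai ⟩
          1ℚ ℚ.* i ℚ.- 1ℚ ℚ.* k
            ≡⟨ cong₂ ℚ._-_ (ℚ.*-identityˡ i) (ℚ.*-identityˡ k) ⟩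
          i ℚ.- k ∎)
          where open ≡-Reasoning

        recip-close : ∀ c j a i b k ε →
          c ℚ.* j ≡ 1ℚ → a ℚ.* i ≡ 1ℚ → b ℚ.* k ≡ 1ℚ →
          0ℚ ℚ.< j → 0ℚ ℚ.< i → 0ℚ ℚ.< k → c ℚ.≤ a → c ℚ.≤ b →
          ℚ.∣ a ℚ.- b ∣ ℚ.≤ ε ℚ.* (c ℚ.* c) → ℚ.∣ i ℚ.- k ∣ ℚ.≤ ε
        recip-close c j a i b k ε cj ai bk 0<j 0<i 0<k c≤a c≤b close = begin
          ℚ.∣ i ℚ.- k ∣
            ≡⟨ cong ℚ.∣_∣ (recip-diff a i b k ai bk) ⟩
          ℚ.∣ k ℚ.* i ℚ.* (b ℚ.- a) ∣
            ≡⟨ ℚ.∣p*q∣≡∣p∣*∣q∣ (k ℚ.* i) (b ℚ.- a) ⟩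
          ℚ.∣ k ℚ.* i ∣ ℚ.* ℚ.∣ b ℚ.- a ∣
            ≡⟨ cong₂ ℚ._*_
                 (ℚ.0≤p⇒∣p∣≡p {k ℚ.* i} (ℚ.<⇒≤ {0ℚ} {k ℚ.* i} (Proofs.*-pos {k} {i} 0<k 0<i)))
                 (trans (sym (ℚ.∣-p∣≡∣p∣ (b ℚ.- a))) (cong ℚ.∣_∣ (Identities.neg-sub b a))) ⟩
          k ℚ.* i ℚ.* ℚ.∣ a ℚ.- b ∣
            ≤⟨ Proofs.*-mono-≤ {k ℚ.* i} {j ℚ.* j} {ℚ.∣ a ℚ.- b ∣} {ε ℚ.* (c ℚ.* c)}
                 (ℚ.0≤∣p∣ (a ℚ.- b)) (ℚ.<⇒≤ {0ℚ} {j ℚ.* j} (Proofs.*-pos {j} {j} 0<j 0<j))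
                 (Proofs.*-mono-≤ {k} {j} {i} {j} (ℚ.<⇒≤ {0ℚ} {i} 0<i) (ℚ.<⇒≤ {0ℚ} {j} 0<j)
                   (recip-anti c j b k cj 0<j bk 0<k c≤b)
                   (recip-anti c j a i cj 0<j ai 0<i c≤a)) close ⟩
          j ℚ.* j ℚ.* (ε ℚ.* (c ℚ.* c))
            ≡⟨ Identities.*-collect j ε c ⟩
          ε ℚ.* (c ℚ.* j ℚ.* (c ℚ.* j))
            ≡⟨ cong (λ z → ε ℚ.* (z ℚ.* z)) cj ⟩
          ε ℚ.* 1ℚ
            ≡⟨ ℚ.*-identityʳ ε ⟩
          ε ∎
          where open ℚ.≤-Reasoning

      recip⁺ : ∀ q → 0ℚ ℚ.< q → ℚ
      recip⁺ q 0<q = ℚ.1/_ q {{ℚ.pos⇒nonZero q {{ℚ.positive {q} 0<q}}}}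

      abstract
        recip⁺-inverse : ∀ q 0<q → q ℚ.* recip⁺ q 0<q ≡ 1ℚ
        recip⁺-inverse q 0<q = ℚ.*-inverseʳ q {{ℚ.pos⇒nonZero q {{ℚ.positive {q} 0<q}}}}

        recip⁺-pos : ∀ q 0<q → 0ℚ ℚ.< recip⁺ q 0<q
        recip⁺-pos q 0<q = ℚ.positive⁻¹ (recip⁺ q 0<q) {{ℚ.1/pos⇒pos q {{ℚ.positive {q} 0<q}}}}

        gap≤term : ∀ x (0<x : 0ℝ < x) n → _<_.gap 0<x ℚ.≤ seq x (_<_.start 0<x ℕ.+ n)
        gap≤term x (mk< c 0<c N h) n =
          subst (ℚ._≤ seq x (N ℕ.+ n)) (ℚ.+-identityˡ c) (h (N ℕ.+ n) (ℕ.m≤m+n N n))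

        0<term : ∀ x (0<x : 0ℝ < x) n → 0ℚ ℚ.< seq x (_<_.start 0<x ℕ.+ n)
        0<term x 0<x n = ℚ.<-≤-trans {0ℚ} {_<_.gap 0<x} (_<_.0<gap 0<x) (gap≤term x 0<x n)

      -- The terms of a positive real are known to be nonzero only from index
      -- `start` on; the sequence of reciprocals is therefore shifted by `start`.
      inv-seq : ∀ x → 0ℝ < x → ℕ → ℚ
      inv-seq x 0<x n = recip⁺ (seq x (_<_.start 0<x ℕ.+ n)) (0<term x 0<x n)

      abstract
        inv-cauchy : ∀ x (0<x : 0ℝ < x) → IsCauchy (inv-seq x 0<x)
        inv-cauchy x 0<x ε 0<ε
          with M , h ← cauchy x (ε ℚ.* (_<_.gap 0<x ℚ.* _<_.gap 0<x))
                 (Proofs.*-pos {ε} 0<ε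
                   (Proofs.*-pos {_<_.gap 0<x} {_<_.gap 0<x} (_<_.0<gap 0<x) (_<_.0<gap 0<x)))
          = M , λ m n p q →
            recip-close c (recip⁺ c 0<c) (a m) (i m) (a n) (i n) ε
              (recip⁺-inverse c 0<c)
              (recip⁺-inverse (a m) (0<term x 0<x m)) (recip⁺-inverse (a n) (0<term x 0<x n))
              (recip⁺-pos c 0<c)
              (recip⁺-pos (a m) (0<term x 0<x m)) (recip⁺-pos (a n) (0<term x 0<x n))
              (gap≤term x 0<x m) (gap≤term x 0<x n)
              (h (N ℕ.+ m) (N ℕ.+ n) (ℕ.≤-trans p (ℕ.m≤n+m m N)) (ℕ.≤-trans q (ℕ.m≤n+m n N)))
          where
          open _<_ 0<x renaming (gap to c; 0<gap to 0<c; start to N)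
          a i : ℕ → ℚ
          a n = seq x (N ℕ.+ n)
          i = inv-seq x 0<x

  inv : (x : ℝ) → 0ℝ < x → ℝ
  inv x 0<x = mkℝ (Inverses.inv-seq x 0<x) (Inverses.inv-cauchy x 0<x)

  x<y⇒0<y-x : ∀ {x y} → x < y → 0ℝ < y - x
  x<y⇒0<y-x {x} {y} (mk< c 0<c N h) = mk< c 0<c N λ n p → begin
    0ℚ ℚ.+ c
      ≡⟨ Identities.add-sub c (seq x n) ⟩
    (seq x n ℚ.+ c) ℚ.- seq x n
      ≤⟨ ℚ.+-monoˡ-≤ (ℚ.- seq x n) (h n p) ⟩
    seq y n ℚ.- seq x n ∎
    where open ℚ.≤-Reasoning

open Real using (ℝ; 0ℝ)

------------------------------------------------------------------------
-- Finite simple graphs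

record Graph : Set₁ where
  field
    V      : Set
    order  : ℕ
    finite : V ↔ Fin order
    Adj    : V → V → Set
    adj?   : Decidable Adj
    irrefl : ∀ {x} → ¬ Adj x x
    symm   : Symmetric Adj

  infix 4 _≟_
  _≟_ : Decidable {A = V} _≡_
  _≟_ = via-injection (↔⇒↣ finite) Fin._≟_

  vertices : List V
  vertices = tabulate (Inverse.from finite)

  degree : V → ℕ
  degree x = length (filter (adj? x) vertices)

  data Walk : V → V → ℕ → Set where
    []  : ∀ {x} → Walk x x 0
    _∷_ : ∀ {x y z k} → Adj x y → Walk y z k → Walk x z (suc k)

  anyVertex? : {P : V → Set} → Decidable₁ P → Dec (∃ P)
  anyVertex? {P} P? = map′
    (λ (i , p) → Inverse.from finite i , p)
    (λ (v , p) → Inverse.to finite v , subst P (sym (Inverse.strictlyInverseʳ finite v)) p)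
    (Fin.any? (P? ∘ Inverse.from finite))

  walk? : ∀ x y → Decidable₁ (Walk x y)
  walk? x y zero    = map′ (λ { refl → [] }) (λ { [] → refl }) (x ≟ y)
  walk? x y (suc k) = map′ (λ (_ , a , w) → a ∷ w) (λ { (a ∷ w) → _ , a , w })
    (anyVertex? λ z → adj? x z ×-dec walk? z y k)

  record Connected : Set where
    field
      someVertex : V
      someWalk   : ∀ x y → ∃ (Walk x y)

open Graph

IsLeast : (ℕ → Set) → ℕ → Set
IsLeast P k = P k × (∀ m → P m → k ℕ.≤ m)

least : {P : ℕ → Set} → Decidable₁ P → ∃ P → ∃ (IsLeast P)
least P? (k , p) = go P? k p
  where
  go : {P : ℕ → Set} → Decidable₁ P → ∀ k → P k → ∃ (IsLeast P)
  go P? zero    p = 0 , p , λ _ _ → z≤n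
  go P? (suc k) p with P? 0
  ... | yes p₀ = 0 , p₀ , λ _ _ → z≤n
  ... | no ¬p₀ with m , pm , min ← go (P? ∘ suc) k p = suc m , pm , λ where
    zero    q → contradiction q ¬p₀
    (suc j) q → s≤s (min j q)

Regular : ℕ → Graph → Set
Regular d G = ∀ x → degree G x ≡ d

------------------------------------------------------------------------
-- Shortest-path distance, Wasserstein distance and curvature

-- The value at 0 is irrelevant: `recip (degree x)` is only used in the
-- presence of a neighbour of x.
recip : ℕ → ℝ
recip zero      = 0ℝ
recip n@(suc _) = Real.fromℚ (ℤ.+ 1 ℚ./ n)

module _ (G : Graph) where

  open Real hiding (ℝ; 0ℝ)

  shortestWalk : Connected G → ∀ x y → ∃ (IsLeast (Walk G x y))
  shortestWalk c x y = least (walk? G x y) (Connected.someWalk c x y)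

  dist : Connected G → V G → V G → ℕ
  dist c x y = proj₁ (shortestWalk c x y)

  ∑ : (V G → ℝ) → ℝ
  ∑ f = foldr (λ v s → f v + s) 0ℝ (vertices G)

  μ : V G → ℝ → V G → ℝ
  μ x α z =
    if does (_≟_ G z x) then α
    else if does (adj? G x z) then (1ℝ - α) * recip (degree G x)
    else 0ℝ

  record IsTransportPlan (ρ σ : V G → ℝ) (π : V G → V G → ℝ) : Set where
    field
      nonNegative : ∀ u v → 0ℝ ≤ π u v
      atMostOne   : ∀ u v → π u v ≤ 1ℝ
      marginalˡ   : ∀ u → ∑ (λ v → π u v) ≈ ρ u
      marginalʳ   : ∀ v → ∑ (λ u → π u v) ≈ σ v

  module _ (conn : Connected G) where

    cost : (V G → V G → ℝ) → ℝ
    cost π = ∑ λ u → ∑ λ v → fromℕ (dist conn u v) * π u v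

    -- W₁(ρ , σ) = w, the minimum being attained.
    record IsW₁ (ρ σ : V G → ℝ) (w : ℝ) : Set where
      field
        optimal   : V G → V G → ℝ
        isPlan    : IsTransportPlan ρ σ optimal
        attained  : cost optimal ≈ w
        isMinimum : ∀ π → IsTransportPlan ρ σ π → w ≤ cost π

    -- κ_α(x , y) = k
    Isκ : ℝ → V G → V G → ℝ → Set
    Isκ α x y k = ∃ λ w → IsW₁ (μ x α) (μ y α) w × k ≈ 1ℝ - w

    -- κ(x , y) = ℓ, that is, κ_α(x , y) / (1 - α) tends to ℓ as α → 1⁻.
    IsLinLuYau : V G → V G → ℝ → Set
    IsLinLuYau x y ℓ =
      ∀ ε → 0ℝ < ε → ∃ λ δ → 0ℝ < δ ×
      (∀ α → 0ℝ ≤ α → 1ℝ - δ < α → (α<1 : α < 1ℝ) →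
       ∃ λ k → Isκ α x y k ×
         (let q = k * inv (1ℝ - α) (x<y⇒0<y-x α<1)
          in ℓ - ε < q × q < ℓ + ε))

    RicciFlat : Set
    RicciFlat = ∀ x y → Adj G x y → IsLinLuYau x y 0ℝ

------------------------------------------------------------------------
-- Isomorphism, symmetry and Cartesian products

infix 4 _≅_

record _≅_ (G H : Graph) : Set where
  field
    bijection : V G ↔ V H
  open Inverse bijection public using (to; from)
  field
    adjacency : ∀ x y → Adj G x y ⇔ Adj H (to x) (to y)

record Symmetricᴳ (G : Graph) : Set where
  field
    vertexTransitive : ∀ x y → Σ (G ≅ G) λ φ → _≅_.to φ x ≡ y
    -- Edges are unordered, so an automorphism may reverse the endpoints.
    edgeTransitive   : ∀ x y x′ y′ → Adj G x y → Adj G x′ y′ →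
      Σ (G ≅ G) λ φ → let open _≅_ φ in
        (to x ≡ x′ × to y ≡ y′) ⊎ (to x ≡ y′ × to y ≡ x′)

-- By the theorem of Lei and Bai this description determines the graph RF⁵₇₂
-- up to isomorphism.
record IsRF⁵₇₂ (H : Graph) : Set where
  field
    order≡72  : order H ≡ 72
    connected : Connected H
    regular   : Regular 5 H
    symmetric : Symmetricᴳ H
    ricciFlat : RicciFlat H connected

infixr 7 _□_

_□_ : Graph → Graph → Graph
X □ Y = record
  { V      = V X × V Y
  ; order  = order X ℕ.* order Y
  ; finite = ↔-trans (finite X ×-↔ finite Y) (↔-sym Fin.*↔×)
  ; Adj    = λ (u , x) (v , y) → (u ≡ v × Adj Y x y) ⊎ (x ≡ y × Adj X u v)
  ; adj?   = λ (u , x) (v , y) →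
      (_≟_ X u v ×-dec adj? Y x y) ⊎-dec (_≟_ Y x y ×-dec adj? X u v)
  ; irrefl = λ { (inj₁ (_ , a)) → irrefl Y a ; (inj₂ (_ , a)) → irrefl X a }
  ; symm   = λ { (inj₁ (p , a)) → inj₁ (sym p , symm Y a)
               ; (inj₂ (p , a)) → inj₂ (sym p , symm X a) }
  }

CartesianProductType : Graph → Set₁
CartesianProductType G =
  ∃₂ λ X Y → 2 ℕ.≤ order X × 2 ℕ.≤ order Y × G ≅ X □ Y

{-# OPTIONS --safe #-}

-- Let T act on (Petersen graph) × (cycle of odd length n) by a reflection φ of the Petersen graph
-- that swaps two adjacent vertices, together with one step along the cycle.  The Petersen edges
-- inside each level and the edges v – T v form a 5-regular bundle over the cycle.  Locally it is
-- the product of the Petersen graph with a line, so every edge has curvature 0: the neighbours of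
-- its ends can be matched at total cost 6 (1+1+2+2 in a fibre, 1+1+1+3 across), and a 1-Lipschitz
-- potential shows that this is optimal.  In a Cartesian product, two edges at a vertex that do not
-- lie in a common square have the same direction; hence all the edges v – T v of an orbit run in
-- one factor and the fibre edges in the other.  Going once around the cycle would then return to
-- the same vertex of the fibre factor, whereas Tⁿ = φ there moves a vertex to a neighbour of it.

module Submission where

open import Defs
open import Data.Nat.Base using (ℕ)
open import Data.Product.Base using (Σ; _×_)
open import Relation.Binary.PropositionalEquality using (_≢_)
open import Relation.Nullary using (¬_)

open import Data.Bool.Base using (true; false; if_then_else_)
open import Data.Fin.Base as Fin using (Fin; zero; suc; inject₁; toℕ)
open import Data.Fin.Induction using (<-weakInduction)
open import Data.Fin.Patterns
open import Data.Fin.Permutation using (↔⇒≡)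
import Data.Fin.Properties as Fin
open import Data.Fin.Relation.Unary.Top using (view; view-fromℕ; view-inject₁; ‵fromℕ; ‵inject₁)
import Data.Integer.Base as ℤ
import Data.Integer.Properties as ℤ
open import Data.List.Base using (List; []; _∷_; map; foldr; filter; length; zip)
import Data.List.Membership.DecPropositional as DecMembership
open import Data.List.Membership.Propositional using (_∈_; _∉_; find)
open import Data.List.Membership.Propositional.Properties
  using (∈-map⁺; ∈-map⁻; ∈-tabulate⁺; ∈-filter⁺; ∈-filter⁻)
open import Data.List.Membership.Propositional.Properties.WithK using (unique∧set⇒bag)
open import Data.List.Properties using (length-map; map-∘)
open import Data.List.Relation.Binary.BagAndSetEquality using (∼bag⇒↭)
open import Data.List.Relation.Binary.Permutation.Propositional.Properties using (↭-length)
open import Data.List.Relation.Unary.All as All using (All; []; _∷_; universal)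
import Data.List.Relation.Unary.All.Properties as All
open import Data.List.Relation.Unary.AllPairs using ([]; _∷_)
open import Data.List.Relation.Unary.Any as Any using (Any; here; there)
import Data.List.Relation.Unary.Unique.DecPropositional as DecUnique
open import Data.List.Relation.Unary.Unique.Propositional using (Unique)
import Data.List.Relation.Unary.Unique.Propositional.Properties as Unique
open import Data.Nat.Base as ℕ using (zero; suc)
open import Data.Nat.GeneralisedArithmetic using (fold)
import Data.Nat.Properties as ℕ
open import Data.Product.Base using (∃; _,_; proj₁; proj₂)
open import Data.Product.Properties using (≡-dec)
open import Data.Rational.Base as ℚ using (ℚ; 0ℚ; 1ℚ)
import Data.Rational.Properties as ℚ
open import Data.Rational.Solver using (module +-*-Solver)
import Data.Rational.Unnormalised.Base as ℚᵘ
import Data.Rational.Unnormalised.Properties as ℚᵘ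
open import Data.Sum.Base using (_⊎_; inj₁; inj₂; swap)
open import Data.Vec.Base as Vec using ([]; _∷_)
open import Function.Base using (_∘_; _$_)
open import Function.Bundles using (mk⇔; mk↔ₛ′; Equivalence; Inverse)
open import Function.Properties.Inverse using (↔-sym; ↔-trans)
open import Relation.Binary.PropositionalEquality hiding ([_])
open import Relation.Nullary using (Dec; yes; no; does; contradiction)
open import Relation.Nullary.Decidable
  using (dec-true; dec-false; from-yes; ¬?; _×-dec_; _→-dec_; map′)

-- Write β = (1 - α)/5, so that α + 5β = 1. Moving α - β along an edge and matching the four other
-- neighbours of its ends at total cost 6 costs (α - β) + 6β = 1. A potential that rises by 1 along
-- the edge and by 6 in total over the matched pairs bounds every plan below by the same number.
-- Hence W₁ is exactly 1 for every α between 1/2 and 1, and the limit defining the curvature is that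
-- of a constant zero. The Petersen graph serves as fibre because it is cubic with girth 5 and
-- diameter 2. Without triangles and squares, the other neighbours of two adjacent vertices are at
-- distance at least 2, and the diameter makes it exactly 2; the absence of squares also drives the
-- direction argument. Since `φ` is an involution, Tⁿ is `φ` on each fibre exactly when n is odd.
-- Length at least 9 keeps up to four steps along the cycle from closing up, leaves room for the
-- potentials to return to their initial value, and gives at least 90 vertices, more than 72.

private variable
  A B : Set

-- Finite sums of rationals

sum : (A → ℚ) → List A → ℚ
sum f = foldr (λ x s → f x ℚ.+ s) 0ℚ

module _ where
  open +-*-Solver

  interchange : ∀ a b c d → (a ℚ.+ b) ℚ.+ (c ℚ.+ d) ≡ (a ℚ.+ c) ℚ.+ (b ℚ.+ d)
  interchange = solve 4 (λ a b c d → (a :+ b) :+ (c :+ d) := (a :+ c) :+ (b :+ d)) refl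

sum-cong : {f g : A → ℚ} → (∀ x → f x ≡ g x) → ∀ xs → sum f xs ≡ sum g xs
sum-cong f≗g []       = refl
sum-cong f≗g (x ∷ xs) = cong₂ ℚ._+_ (f≗g x) (sum-cong f≗g xs)

sum-mono : {f g : A → ℚ} → ∀ {xs} → All (λ x → f x ℚ.≤ g x) xs → sum f xs ℚ.≤ sum g xs
sum-mono []       = ℚ.≤-refl
sum-mono (p ∷ ps) = ℚ.+-mono-≤ p (sum-mono ps)

sum-map : (f : B → ℚ) (h : A → B) → ∀ xs → sum f (map h xs) ≡ sum (f ∘ h) xs
sum-map f h []       = refl
sum-map f h (x ∷ xs) = cong (f (h x) ℚ.+_) (sum-map f h xs)

sum-zero : (xs : List A) → sum (λ _ → 0ℚ) xs ≡ 0ℚ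
sum-zero []       = refl
sum-zero (x ∷ xs) = trans (ℚ.+-identityˡ _) (sum-zero xs)

sum-+ : (f g : A → ℚ) → ∀ xs → sum (λ x → f x ℚ.+ g x) xs ≡ sum f xs ℚ.+ sum g xs
sum-+ f g []       = sym (ℚ.+-identityʳ 0ℚ)
sum-+ f g (x ∷ xs) = trans (cong (f x ℚ.+ g x ℚ.+_) (sum-+ f g xs))
                           (interchange (f x) (g x) (sum f xs) (sum g xs))

sum-*ˡ : ∀ c (f : A → ℚ) → ∀ xs → sum (λ x → c ℚ.* f x) xs ≡ c ℚ.* sum f xs
sum-*ˡ c f []       = sym (ℚ.*-zeroʳ c)
sum-*ˡ c f (x ∷ xs) = trans (cong (c ℚ.* f x ℚ.+_) (sum-*ˡ c f xs))
                            (sym (ℚ.*-distribˡ-+ c (f x) (sum f xs)))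

sum-*ʳ : ∀ c (f : A → ℚ) → ∀ xs → sum (λ x → f x ℚ.* c) xs ≡ sum f xs ℚ.* c
sum-*ʳ c f []       = sym (ℚ.*-zeroˡ c)
sum-*ʳ c f (x ∷ xs) = trans (cong (f x ℚ.* c ℚ.+_) (sum-*ʳ c f xs))
                            (sym (ℚ.*-distribʳ-+ c (f x) (sum f xs)))

sum-swap : (f : A → B → ℚ) → ∀ xs ys →
           sum (λ x → sum (f x) ys) xs ≡ sum (λ y → sum (λ x → f x y) xs) ys
sum-swap f []       ys = sym (sum-zero ys)
sum-swap f (x ∷ xs) ys = trans (cong (sum (f x) ys ℚ.+_) (sum-swap f xs ys))
                               (sym (sum-+ (f x) (λ y → sum (λ x → f x y) xs) ys))

sum-vanish : {f : A → ℚ} → ∀ {xs} → All (λ x → f x ≡ 0ℚ) xs → sum f xs ≡ 0ℚ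
sum-vanish []       = refl
sum-vanish (p ∷ ps) = cong₂ ℚ._+_ p (sum-vanish ps)

sum-single : {f : A → ℚ} {x : A} → ∀ {xs} → Unique xs → x ∈ xs →
             (∀ y → x ≢ y → f y ≡ 0ℚ) → sum f xs ≡ f x
sum-single {f = f} {x} (x∉ ∷ _) (here refl) vanish =
  trans (cong (f x ℚ.+_) (sum-vanish (All.map (vanish _) x∉))) (ℚ.+-identityʳ (f x))
sum-single {f = f} (y∉ ∷ u) (there x∈) vanish =
  trans (cong₂ ℚ._+_ (vanish _ (λ x≡y → All.lookup y∉ x∈ (sym x≡y))) (sum-single u x∈ vanish))
        (ℚ.+-identityˡ _)

ι : ℕ → ℚ
ι n = ℤ.+ n ℚ./ 1

opaque

  -- `ι` normalises its fraction, so the identity is checked on unnormalised representatives, where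
  -- both denominators are 1.
  ι-+ : ∀ m n → ι (m ℕ.+ n) ≡ ι m ℚ.+ ι n
  ι-+ m n = ℚ.toℚᵘ-injective (begin
    ℚ.toℚᵘ (ι (m ℕ.+ n))           ≈⟨ ℚ.toℚᵘ-fromℚᵘ (ℚᵘ.mkℚᵘ (ℤ.+ (m ℕ.+ n)) 0) ⟩
    ℚᵘ.mkℚᵘ (ℤ.+ (m ℕ.+ n)) 0      ≈⟨ ℚᵘ.*≡* (cong (ℤ._* ℤ.1ℤ)
      (sym (cong₂ ℤ._+_ (ℤ.*-identityʳ (ℤ.+ m)) (ℤ.*-identityʳ (ℤ.+ n))))) ⟩
    ℚᵘ.mkℚᵘ (ℤ.+ m) 0 ℚᵘ.+ ℚᵘ.mkℚᵘ (ℤ.+ n) 0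
      ≈⟨ ℚᵘ.+-cong (ℚ.toℚᵘ-fromℚᵘ (ℚᵘ.mkℚᵘ (ℤ.+ m) 0)) (ℚ.toℚᵘ-fromℚᵘ (ℚᵘ.mkℚᵘ (ℤ.+ n) 0)) ⟨
    ℚ.toℚᵘ (ι m) ℚᵘ.+ ℚ.toℚᵘ (ι n) ≈⟨ ℚ.toℚᵘ-homo-+ (ι m) (ι n) ⟨
    ℚ.toℚᵘ (ι m ℚ.+ ι n)           ∎)
    where open import Relation.Binary.Reasoning.Setoid ℚᵘ.≃-setoid

  ι-mono : ∀ {m n} → m ℕ.≤ n → ι m ℚ.≤ ι n
  ι-mono {m} {n} m≤n = ℚ.toℚᵘ-cancel-≤ (begin
    ℚ.toℚᵘ (ι m)       ≃⟨ ℚ.toℚᵘ-fromℚᵘ (ℚᵘ.mkℚᵘ (ℤ.+ m) 0) ⟩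
    ℚᵘ.mkℚᵘ (ℤ.+ m) 0  ≤⟨ ℚᵘ.*≤* (ℤ.*-monoʳ-≤-nonNeg ℤ.1ℤ (ℤ.+≤+ m≤n)) ⟩
    ℚᵘ.mkℚᵘ (ℤ.+ n) 0  ≃⟨ ℚ.toℚᵘ-fromℚᵘ (ℚᵘ.mkℚᵘ (ℤ.+ n) 0) ⟨
    ℚ.toℚᵘ (ι n)       ∎)
    where open ℚᵘ.≤-Reasoning

sum-ι : (k : A → ℕ) → ∀ xs → sum (ι ∘ k) xs ≡ ι (foldr (λ x s → k x ℕ.+ s) 0 xs)
sum-ι k []       = refl
sum-ι k (x ∷ xs) = trans (cong (ι (k x) ℚ.+_) (sum-ι k xs)) (sym (ι-+ (k x) _))

-- The order of the Cauchy reals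

module RealOrder where

  open Real

  termwise-≤ : ∀ {x y} → (∃ λ N → ∀ n → N ℕ.≤ n → seq x n ℚ.≤ seq y n) → x ≤ y
  termwise-≤ {x} {y} (N , h) = mk≤ λ ε 0<ε → N , λ n N≤n →
    ℚ.≤-trans (h n N≤n) (subst (ℚ._≤ seq y n ℚ.+ ε) (ℚ.+-identityʳ (seq y n))
      (ℚ.+-monoʳ-≤ (seq y n) (ℚ.<⇒≤ 0<ε)))

  termwise-≈ : ∀ {x y} → (∀ n → seq x n ≡ seq y n) → x ≈ y
  termwise-≈ h = termwise-≤ (0 , λ n _ → ℚ.≤-reflexive (h n)) ,
                 termwise-≤ (0 , λ n _ → ℚ.≤-reflexive (sym (h n)))

  private
    half-pos : ∀ {ε} → 0ℚ ℚ.< ε → 0ℚ ℚ.< ε ℚ.* ℚ.½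
    half-pos {ε} p = subst (ℚ._< ε ℚ.* ℚ.½) (ℚ.*-zeroˡ ℚ.½) (ℚ.*-monoˡ-<-pos ℚ.½ p)

    half+half : ∀ ε → ε ℚ.* ℚ.½ ℚ.+ ε ℚ.* ℚ.½ ≡ ε
    half+half ε = trans (sym (ℚ.*-distribˡ-+ ε ℚ.½ ℚ.½)) (ℚ.*-identityʳ ε)

  ≤-refl : ∀ {x} → x ≤ x
  ≤-refl {x} = termwise-≤ {x} {x} (0 , λ _ _ → ℚ.≤-refl)

  ≤-trans : ∀ {x y z} → x ≤ y → y ≤ z → x ≤ z
  ≤-trans {x} {y} {z} (mk≤ f) (mk≤ g) = mk≤ λ ε 0<ε →
    let M , p = f (ε ℚ.* ℚ.½) (half-pos 0<ε)
        N , q = g (ε ℚ.* ℚ.½) (half-pos 0<ε)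
    in M ℕ.⊔ N , λ n M⊔N≤n → begin
         seq x n
           ≤⟨ p n (ℕ.m⊔n≤o⇒m≤o M N M⊔N≤n) ⟩
         seq y n ℚ.+ ε ℚ.* ℚ.½
           ≤⟨ ℚ.+-monoˡ-≤ (ε ℚ.* ℚ.½) (q n (ℕ.m⊔n≤o⇒n≤o M N M⊔N≤n)) ⟩
         seq z n ℚ.+ ε ℚ.* ℚ.½ ℚ.+ ε ℚ.* ℚ.½
           ≡⟨ ℚ.+-assoc (seq z n) (ε ℚ.* ℚ.½) (ε ℚ.* ℚ.½) ⟩
         seq z n ℚ.+ (ε ℚ.* ℚ.½ ℚ.+ ε ℚ.* ℚ.½)
           ≡⟨ cong (seq z n ℚ.+_) (half+half ε) ⟩
         seq z n ℚ.+ ε ∎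
    where open ℚ.≤-Reasoning

  +-mono-≤ : ∀ {x y u v} → x ≤ y → u ≤ v → x + u ≤ y + v
  +-mono-≤ {x} {y} {u} {v} (mk≤ f) (mk≤ g) = mk≤ λ ε 0<ε →
    let M , p = f (ε ℚ.* ℚ.½) (half-pos 0<ε)
        N , q = g (ε ℚ.* ℚ.½) (half-pos 0<ε)
    in M ℕ.⊔ N , λ n M⊔N≤n → begin
         seq x n ℚ.+ seq u n
           ≤⟨ ℚ.+-mono-≤ (p n (ℕ.m⊔n≤o⇒m≤o M N M⊔N≤n)) (q n (ℕ.m⊔n≤o⇒n≤o M N M⊔N≤n)) ⟩
         (seq y n ℚ.+ ε ℚ.* ℚ.½) ℚ.+ (seq v n ℚ.+ ε ℚ.* ℚ.½)
           ≡⟨ interchange (seq y n) (ε ℚ.* ℚ.½) (seq v n) (ε ℚ.* ℚ.½) ⟩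
         (seq y n ℚ.+ seq v n) ℚ.+ (ε ℚ.* ℚ.½ ℚ.+ ε ℚ.* ℚ.½)
           ≡⟨ cong (seq y n ℚ.+ seq v n ℚ.+_) (half+half ε) ⟩
         seq y n ℚ.+ seq v n ℚ.+ ε ∎
    where open ℚ.≤-Reasoning

  -- Peeling off one summand at a time, (k + 1)x = x + kx, reduces the claim to monotonicity of
  -- addition, with no rescaling of ε. This is why potentials and distances are kept in ℕ.
  fromℕ-*-mono-≤ : ∀ k {x y} → x ≤ y → fromℕ k * x ≤ fromℕ k * y
  fromℕ-*-mono-≤ zero    {x} {y} _   = termwise-≤ {fromℕ 0 * x} {fromℕ 0 * y} (0 , λ n _ →
    ℚ.≤-reflexive (trans (ℚ.*-zeroˡ (seq x n)) (sym (ℚ.*-zeroˡ (seq y n)))))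
  fromℕ-*-mono-≤ (suc k) {x} {y} x≤y =
    ≤-trans {fromℕ (suc k) * x} {x + fromℕ k * x} {fromℕ (suc k) * y}
      (proj₁ (unfold x))
      (≤-trans {x + fromℕ k * x} {y + fromℕ k * y} {fromℕ (suc k) * y}
        (+-mono-≤ {x} {y} {fromℕ k * x} {fromℕ k * y} x≤y (fromℕ-*-mono-≤ k {x} {y} x≤y))
        (proj₂ (unfold y)))
    where
    unfold : ∀ z → fromℕ (suc k) * z ≈ z + fromℕ k * z
    unfold z = termwise-≈ {fromℕ (suc k) * z} {z + fromℕ k * z} λ n →
      trans (cong (ℚ._* seq z n) (ι-+ 1 k))
        (trans (ℚ.*-distribʳ-+ (seq z n) 1ℚ (ι k))
               (cong (ℚ._+ ι k ℚ.* seq z n) (ℚ.*-identityˡ (seq z n))))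

  sumℝ : (A → ℝ) → List A → ℝ
  sumℝ f = foldr (λ x s → f x + s) 0ℝ

  -- Brings identities between real sums down to rational ones at a fixed index.
  seq-sumℝ : (f : A → ℝ) → ∀ xs n → seq (sumℝ f xs) n ≡ sum (λ x → seq (f x) n) xs
  seq-sumℝ f []       n = refl
  seq-sumℝ f (x ∷ xs) n = cong (seq (f x) n ℚ.+_) (seq-sumℝ f xs n)

  sumℝ-mono : {f g : A → ℝ} → (∀ x → f x ≤ g x) → ∀ xs → sumℝ f xs ≤ sumℝ g xs
  sumℝ-mono         f≤g []       = ≤-refl {0ℝ}
  sumℝ-mono {f = f} {g} f≤g (x ∷ xs) =
    +-mono-≤ {f x} {g x} {sumℝ f xs} {sumℝ g xs} (f≤g x) (sumℝ-mono f≤g xs)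

-- Curvature zero from a transport plan and a potential

record _enumerates_ {A : Set} (xs : List A) (P : A → Set) : Set where
  field
    unique   : Unique xs
    sound    : All P xs
    complete : ∀ {x} → P x → x ∈ xs

open _enumerates_

infix 5 [_]_

-- The Iverson bracket of a decision, multiplied by a rational.
[_]_ : {P : Set} → Dec P → ℚ → ℚ
[ P? ] c = if does P? then c else 0ℚ

[]-yes : {P : Set} (P? : Dec P) → P → ∀ c → [ P? ] c ≡ c
[]-yes P? p c = cong (if_then c else 0ℚ) (dec-true P? p)

[]-no : {P : Set} (P? : Dec P) → ¬ P → ∀ c → [ P? ] c ≡ 0ℚ
[]-no P? ¬p c = cong (if_then c else 0ℚ) (dec-false P? ¬p)

[]-+ : {P : Set} (P? : Dec P) → ∀ c d → [ P? ] (c ℚ.+ d) ≡ ([ P? ] c) ℚ.+ ([ P? ] d)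
[]-+ (yes _) c d = refl
[]-+ (no _)  c d = refl

[]-≤ : {P : Set} (P? : Dec P) → ∀ {c} → 0ℚ ℚ.≤ c → [ P? ] c ℚ.≤ c
[]-≤ (yes _) _   = ℚ.≤-refl
[]-≤ (no _)  0≤c = 0≤c

[]-≥0 : {P : Set} (P? : Dec P) → ∀ {c} → 0ℚ ℚ.≤ c → 0ℚ ℚ.≤ [ P? ] c
[]-≥0 (yes _) 0≤c = 0≤c
[]-≥0 (no _)  _   = ℚ.≤-refl

-- Vertex sums, the measures μ, and certificates of flatness

module _ (G : Graph) where

  open Graph G

  infix 5 [_≐_]_

  [_≐_]_ : V → V → ℚ → ℚ
  [ u ≐ v ] c = [ u ≟ v ] c

  vertices-unique : Unique vertices
  vertices-unique = Unique.tabulate⁺ λ {i} {j} eq →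
    trans (sym (Inverse.strictlyInverseˡ finite i))
      (trans (cong (Inverse.to finite) eq) (Inverse.strictlyInverseˡ finite j))

  vertices-complete : ∀ v → v ∈ vertices
  vertices-complete v = subst (_∈ vertices) (Inverse.strictlyInverseʳ finite v)
    (∈-tabulate⁺ (Inverse.to finite v))

  -- Duplicate-free lists with the same elements are permutations of each other, so any enumeration
  -- of the neighbours computes the degree.
  degree≡length : ∀ x {L} → L enumerates Adj x → degree x ≡ length L
  degree≡length x {L} e = ↭-length $ ∼bag⇒↭ $ unique∧set⇒bag
    (Unique.filter⁺ (adj? x) vertices-unique) (unique e) λ {v} → mk⇔
      (complete e ∘ proj₂ ∘ ∈-filter⁻ (adj? x) {xs = vertices})
      (λ v∈L → ∈-filter⁺ (adj? x) (vertices-complete v) (All.lookup (sound e) v∈L))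

  sum-pointˡ : (F : V → ℚ) → ∀ w → sum (λ v → [ v ≐ w ] F v) vertices ≡ F w
  sum-pointˡ F w = trans
    (sum-single vertices-unique (vertices-complete w) λ v w≢v → []-no (v ≟ w) (w≢v ∘ sym) (F v))
    ([]-yes (w ≟ w) refl (F w))

  private
    *-[] : {P : Set} (P? : Dec P) → ∀ c d → c ℚ.* ([ P? ] d) ≡ [ P? ] (c ℚ.* d)
    *-[] (yes _) c d = refl
    *-[] (no _)  c d = ℚ.*-zeroʳ c

  sum-*-point : (F : V → ℚ) → ∀ w c → sum (λ v → F v ℚ.* ([ v ≐ w ] c)) vertices ≡ F w ℚ.* c
  sum-*-point F w c = trans (sum-cong (λ v → *-[] (v ≟ w) (F v) c) vertices)
                            (sum-pointˡ (λ v → F v ℚ.* c) w)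

  sum-∈ : ∀ {L} → Unique L → ∀ {z} → z ∈ L → ∀ c → sum (λ w → [ z ≐ w ] c) L ≡ c
  sum-∈ u {z} z∈L c = trans
    (sum-single u z∈L λ w z≢w → []-no (z ≟ w) z≢w c)
    ([]-yes (z ≟ z) refl c)

  sum-∉ : ∀ {L z} → z ∉ L → ∀ c → sum (λ w → [ z ≐ w ] c) L ≡ 0ℚ
  sum-∉ {L} {z} z∉L c = sum-vanish
    (All.tabulate λ {w} w∈L → []-no (z ≟ w) (λ { refl → z∉L w∈L }) c)

  open Real
  open RealOrder

  seq-∑ : (f : V → ℝ) → ∀ n → seq (∑ G f) n ≡ sum (λ v → seq (f v) n) vertices
  seq-∑ f n = seq-sumℝ f vertices n

  ∑-mono : {f g : V → ℝ} → (∀ v → f v ≤ g v) → ∑ G f ≤ ∑ G g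
  ∑-mono {f} {g} f≤g = sumℝ-mono {f = f} {g} f≤g vertices

  share : ℚ → ℚ
  share a = (1ℚ ℚ.- a) ℚ.* (ℤ.+ 1 ℚ./ 5)

  module _ {x : V} {L : List V} (e : L enumerates Adj x) (five : length L ≡ 5) (α : ℝ) where

    -- The nested conditionals become a sum of point masses: `x` is not its own neighbour, and each
    -- neighbour occurs once in `L`.
    seq-μ : ∀ z n → seq (μ G x α z) n ≡
            ([ z ≐ x ] seq α n) ℚ.+ sum (λ w → [ z ≐ w ] share (seq α n)) L
    -- For an abstract graph the degree does not compute; it has to be replaced by 5 before `recip`
    -- can reduce.
    seq-μ z n = subst
      (λ d → seq (μ-with (recip d)) n ≡ ([ z ≐ x ] seq α n) ℚ.+ sum (λ w → [ z ≐ w ] b) L)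
      (sym (trans (degree≡length x e) five))
      (cases (z ≟ x) (adj? x z)
        (λ z≡x → sum-∉ (λ z∈L → irrefl (subst (Adj x) z≡x (All.lookup (sound e) z∈L))) b)
        (λ a → sum-∈ (unique e) (complete e a) b)
        (λ ¬a → sum-∉ (¬a ∘ All.lookup (sound e)) b))
      where
      b : ℚ
      b = share (seq α n)
      μ-with : ℝ → ℝ
      μ-with r = if does (z ≟ x) then α
                 else if does (adj? x z) then (1ℝ - α) * r
                 else 0ℝ
      cases : {P Q : Set} (P? : Dec P) (Q? : Dec Q) {s : ℚ} →
              (P → s ≡ 0ℚ) → (Q → s ≡ b) → (¬ Q → s ≡ 0ℚ) →
              seq (if does P? then α else if does Q? then (1ℝ - α) * recip 5 else 0ℝ) n
              ≡ ([ P? ] seq α n) ℚ.+ s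
      cases (yes p) _       x→0 _   _   = sym (trans (cong (seq α n ℚ.+_) (x→0 p)) (ℚ.+-identityʳ _))
      cases (no _)  (yes q) _   a→b _   = sym (trans (ℚ.+-identityˡ _) (a→b q))
      cases (no _)  (no ¬q) _   _   a→0 = sym (trans (ℚ.+-identityˡ _) (a→0 ¬q))

    sum-*-μ : (F : V → ℚ) → ∀ n → sum (λ z → F z ℚ.* seq (μ G x α z) n) vertices ≡
              F x ℚ.* seq α n ℚ.+ sum F L ℚ.* share (seq α n)
    sum-*-μ F n = begin
      sum (λ z → F z ℚ.* seq (μ G x α z) n) vertices
        ≡⟨ sum-cong (λ z → trans (cong (F z ℚ.*_) (seq-μ z n))
             (trans (ℚ.*-distribˡ-+ (F z) ([ z ≐ x ] a) (sum (λ w → [ z ≐ w ] b) L))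
               (cong (F z ℚ.* ([ z ≐ x ] a) ℚ.+_) (sym (sum-*ˡ (F z) (λ w → [ z ≐ w ] b) L))))) vertices ⟩
      sum (λ z → F z ℚ.* ([ z ≐ x ] a) ℚ.+ sum (λ w → F z ℚ.* ([ z ≐ w ] b)) L) vertices
        ≡⟨ sum-+ (λ z → F z ℚ.* ([ z ≐ x ] a)) (λ z → sum (λ w → F z ℚ.* ([ z ≐ w ] b)) L) vertices ⟩
      sum (λ z → F z ℚ.* ([ z ≐ x ] a)) vertices ℚ.+
      sum (λ z → sum (λ w → F z ℚ.* ([ z ≐ w ] b)) L) vertices
        ≡⟨ cong₂ ℚ._+_ (sum-*-point F x a)
             (trans (sum-swap (λ z w → F z ℚ.* ([ z ≐ w ] b)) vertices L)
               (trans (sum-cong (λ w → sum-*-point F w b) L) (sum-*ʳ b F L))) ⟩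
      F x ℚ.* a ℚ.+ sum F L ℚ.* b ∎
      where
      open ≡-Reasoning
      a b : ℚ
      a = seq α n
      b = share a

  -- A primal-dual certificate. The walks bound the distances of matched pairs from above, and
  -- `height` is the dual solution; both totals are 6 because (α - β) + 6β = α + 5β = 1.
  record FlatEdge (x y : V) : Set where
    field
      matched : List (V × V × ℕ)
      walks   : All (λ (z , w , k) → Walk z w k) matched
      cost≡6  : foldr (λ (_ , _ , k) s → k ℕ.+ s) 0 matched ≡ 6
      four    : length matched ≡ 4
      nbrsˡ   : (y ∷ map proj₁ matched) enumerates Adj x
      nbrsʳ   : (x ∷ map (proj₁ ∘ proj₂) matched) enumerates Adj y
      height    : V → ℕ
      lipschitz : ∀ {u v} → Adj u v → height v ℕ.≤ suc (height u)
      rise      : height y ≡ suc (height x)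
      drop      : foldr (λ (_ , w , _) s → height w ℕ.+ s) 0 matched
                  ≡ 6 ℕ.+ foldr (λ (z , _ , _) s → height z ℕ.+ s) 0 matched

  lipschitz-walk : (h : V → ℕ) → (∀ {u v} → Adj u v → h v ℕ.≤ suc (h u)) →
                   ∀ {u v k} → Walk u v k → h v ℕ.≤ k ℕ.+ h u
  lipschitz-walk h lip []      = ℕ.≤-refl
  lipschitz-walk h lip {u} (_∷_ {k = k} a w) = ℕ.≤-trans (lipschitz-walk h lip w)
    (ℕ.≤-trans (ℕ.+-monoʳ-≤ k (lip a)) (ℕ.≤-reflexive (ℕ.+-suc k (h u))))

  module _ (conn : Graph.Connected G) where

    dist≤ : ∀ {u v k} → Walk u v k → dist G conn u v ℕ.≤ k
    dist≤ {u} {v} w = proj₂ (proj₂ (shortestWalk G conn u v)) _ w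

    height≤ : (h : V → ℕ) → (∀ {u v} → Adj u v → h v ℕ.≤ suc (h u)) →
              ∀ u v → h v ℕ.≤ dist G conn u v ℕ.+ h u
    height≤ h lip u v = lipschitz-walk h lip (proj₁ (proj₂ (shortestWalk G conn u v)))

    -- Kantorovich duality, with the potential moved to the right-hand side so that it may
    -- take values in ℕ.
    duality : (h : V → ℕ) → (∀ {u v} → Adj u v → h v ℕ.≤ suc (h u)) →
              ∀ {ρ σ π} → IsTransportPlan G ρ σ π →
              ∑ G (λ v → fromℕ (h v) * σ v) ≤
              cost G conn π + ∑ G (λ u → fromℕ (h u) * ρ u)
    duality h lip {ρ} {σ} {π} plan =
      ≤-trans {∑ G (λ v → fromℕ (h v) * σ v)}
              {∑ G (λ v → fromℕ (h v) * ∑ G (λ u → π u v))} {rhs}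
        (∑-mono {λ v → fromℕ (h v) * σ v} {λ v → fromℕ (h v) * ∑ G (λ u → π u v)}
          λ v → fromℕ-*-mono-≤ (h v) {σ v} {∑ G (λ u → π u v)} (proj₂ (marginalʳ v)))
      (≤-trans {∑ G (λ v → fromℕ (h v) * ∑ G (λ u → π u v))} {mid} {rhs}
        (proj₁ (termwise-≈ {∑ G (λ v → fromℕ (h v) * ∑ G (λ u → π u v))} {mid} swapped))
      (≤-trans {mid} {mid′} {rhs}
        (∑-mono {λ u → ∑ G λ v → fromℕ (h v) * π u v}
                {λ u → ∑ G λ v → fromℕ (dist G conn u v) * π u v +
                                 fromℕ (h u) * π u v} λ u →
         ∑-mono {λ v → fromℕ (h v) * π u v}
                {λ v → fromℕ (dist G conn u v) * π u v +
                       fromℕ (h u) * π u v} λ v → pointwise u v)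
      (≤-trans {mid′} {cost G conn π + ∑ G (λ u → fromℕ (h u) * ∑ G (λ v → π u v))} {rhs}
        (proj₁ (termwise-≈ {mid′} {cost G conn π + ∑ G (λ u → fromℕ (h u) * ∑ G (λ v → π u v))} split))
        (+-mono-≤ {cost G conn π} {cost G conn π}
                  {∑ G (λ u → fromℕ (h u) * ∑ G (λ v → π u v))}
                  {∑ G (λ u → fromℕ (h u) * ρ u)}
          (≤-refl {cost G conn π})
          (∑-mono {λ u → fromℕ (h u) * ∑ G (λ v → π u v)}
                  {λ u → fromℕ (h u) * ρ u}
            λ u → fromℕ-*-mono-≤ (h u) {∑ G (λ v → π u v)} {ρ u} (proj₁ (marginalˡ u)))))))
      where
      open IsTransportPlan plan
      rhs mid mid′ : ℝ
      rhs = cost G conn π + ∑ G (λ u → fromℕ (h u) * ρ u)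
      mid = ∑ G λ u → ∑ G λ v → fromℕ (h v) * π u v
      mid′ = ∑ G λ u → ∑ G λ v → fromℕ (dist G conn u v) * π u v +
                                 fromℕ (h u) * π u v

      module _ (n : ℕ) where
        p : V → V → ℚ
        p u v = seq (π u v) n

        seq-∑∑ : (f : V → V → ℝ) → seq (∑ G λ u → ∑ G (f u)) n ≡
                 sum (λ u → sum (λ v → seq (f u v) n) vertices) vertices
        seq-∑∑ f = trans (seq-∑ (λ u → ∑ G (f u)) n)
                         (sum-cong (λ u → seq-∑ (f u) n) vertices)

        seq-∑*∑ : (f : V → V → ℝ) → seq (∑ G λ u → fromℕ (h u) * ∑ G (f u)) n ≡
                  sum (λ u → sum (λ v → ι (h u) ℚ.* seq (f u v) n) vertices) vertices
        seq-∑*∑ f = trans (seq-∑ (λ u → fromℕ (h u) * ∑ G (f u)) n)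
          (sum-cong (λ u → trans (cong (ι (h u) ℚ.*_) (seq-∑ (f u) n))
                                 (sym (sum-*ˡ (ι (h u)) (λ v → seq (f u v) n) vertices))) vertices)

        swapped : seq (∑ G (λ v → fromℕ (h v) * ∑ G (λ u → π u v))) n ≡ seq mid n
        swapped = trans (seq-∑*∑ (λ v u → π u v))
          (trans (sum-swap (λ v u → ι (h v) ℚ.* p u v) vertices vertices)
                 (sym (seq-∑∑ (λ u v → fromℕ (h v) * π u v))))

        split : seq mid′ n ≡
                seq (cost G conn π + ∑ G (λ u → fromℕ (h u) * ∑ G (λ v → π u v))) n
        split = trans (seq-∑∑ (λ u v → fromℕ (dist G conn u v) * π u v +
                                       fromℕ (h u) * π u v))
          (trans (sum-cong (λ u → sum-+ (d u) (e u) vertices) vertices)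
          (trans (sum-+ (λ u → sum (d u) vertices) (λ u → sum (e u) vertices) vertices)
                 (sym (cong₂ ℚ._+_ (seq-∑∑ (λ u v → fromℕ (dist G conn u v) * π u v))
                                   (seq-∑*∑ π)))))
          where
          d e : V → V → ℚ
          d u v = ι (dist G conn u v) ℚ.* p u v
          e u v = ι (h u) ℚ.* p u v

      pointwise : ∀ u v → fromℕ (h v) * π u v ≤
                  fromℕ (dist G conn u v) * π u v + fromℕ (h u) * π u v
      pointwise u v =
        -- The slack `j` of the Lipschitz inequality is a natural number; adding `j` times the
        -- nonnegative mass turns the inequality into an equation of coefficients.
        ≤-trans {hv*π} {hv*π + fromℕ j * π u v} {target}
          (≤-trans {hv*π} {hv*π + fromℕ j * 0ℝ} {hv*π + fromℕ j * π u v}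
            (proj₁ (termwise-≈ {hv*π} {hv*π + fromℕ j * 0ℝ} λ n →
              sym (trans (cong (ι (h v) ℚ.* p n u v ℚ.+_) (ℚ.*-zeroʳ (ι j))) (ℚ.+-identityʳ _))))
            (+-mono-≤ {hv*π} {hv*π} {fromℕ j * 0ℝ} {fromℕ j * π u v}
              (≤-refl {hv*π}) (fromℕ-*-mono-≤ j {0ℝ} {π u v} (nonNegative u v))))
          (proj₁ (termwise-≈ {hv*π + fromℕ j * π u v} {target} λ n →
            trans (sym (ℚ.*-distribʳ-+ (p n u v) (ι (h v)) (ι j)))
            (trans (cong (ℚ._* p n u v) (trans (sym (ι-+ (h v) j))
                (trans (cong ι (ℕ.m+[n∸m]≡n (height≤ h lip u v))) (ι-+ (dist G conn u v) (h u)))))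
              (ℚ.*-distribʳ-+ (p n u v) (ι (dist G conn u v)) (ι (h u))))))
        where
        j : ℕ
        j = dist G conn u v ℕ.+ h u ℕ.∸ h v
        hv*π target : ℝ
        hv*π = fromℕ (h v) * π u v
        target = fromℕ (dist G conn u v) * π u v + fromℕ (h u) * π u v

  sum-const : ∀ c (xs : List A) → sum (λ _ → c) xs ≡ ι (length xs) ℚ.* c
  sum-const c []       = sym (ℚ.*-zeroˡ c)
  sum-const c (_ ∷ xs) = trans (cong₂ ℚ._+_ (sym (ℚ.*-identityˡ c)) (sum-const c xs))
    (trans (sym (ℚ.*-distribʳ-+ c 1ℚ (ι (length xs)))) (cong (ℚ._* c) (sym (ι-+ 1 (length xs)))))

  -- The explicit plan and its optimality

  module Optimal {x y : V} (edge : FlatEdge x y) (α : ℝ) where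

    open FlatEdge edge

    β γ : ℝ
    β = (1ℝ - α) * recip 5
    γ = α - β

    -- Mass β stays at x and at y, the excess α − β of x over y moves along the edge, and the
    -- other neighbours are matched.
    shipments : List (V × V × ℝ)
    shipments = (x , x , β) ∷ (x , y , γ) ∷ (y , y , β) ∷ map (λ (z , w , _) → z , w , β) matched

    plan : V → V → ℝ
    plan u v = sumℝ (λ (z , w , m) → if does (u ≟ z) then if does (v ≟ w) then m else 0ℝ else 0ℝ)
                    shipments

    module _ (n : ℕ) where

      a b : ℚ
      a = seq α n
      b = share a

      seq-plan : ∀ u v → seq (plan u v) n ≡
                 sum (λ (z , w , m) → [ u ≐ z ] [ v ≐ w ] seq m n) shipments
      seq-plan u v = trans
        (seq-sumℝ (λ (z , w , m) → if does (u ≟ z) then if does (v ≟ w) then m else 0ℝ else 0ℝ)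
                  shipments n)
        (sum-cong (λ (z , w , m) → cases (u ≟ z) (v ≟ w) m) shipments)
        where
        cases : {P Q : Set} (P? : Dec P) (Q? : Dec Q) → ∀ m →
                seq (if does P? then if does Q? then m else 0ℝ else 0ℝ) n ≡ [ P? ] [ Q? ] seq m n
        cases (yes _) (yes _) m = refl
        cases (yes _) (no _)  m = refl
        cases (no _)  _       m = refl

      private
        []-sum : {P : Set} (P? : Dec P) → ∀ w c → sum (λ v → [ P? ] [ v ≐ w ] c) vertices ≡ [ P? ] c
        []-sum (yes _) w c = sum-pointˡ (λ _ → c) w
        []-sum (no _)  w c = sum-zero vertices

        []-swap : {P Q : Set} (P? : Dec P) (Q? : Dec Q) → ∀ c → [ P? ] [ Q? ] c ≡ [ Q? ] [ P? ] c
        []-swap (yes _) (yes _) c = refl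
        []-swap (yes _) (no _)  c = refl
        []-swap (no _)  (yes _) c = refl
        []-swap (no _)  (no _)  c = refl

        *-[][] : {P Q : Set} (P? : Dec P) (Q? : Dec Q) → ∀ c d →
                 c ℚ.* ([ P? ] [ Q? ] d) ≡ [ P? ] [ Q? ] c ℚ.* d
        *-[][] (yes _) Q? c d = *-[] Q? c d
        *-[][] (no _)  Q? c d = ℚ.*-zeroʳ c

      sum-row : ∀ u → sum (λ v → seq (plan u v) n) vertices ≡
                sum (λ (z , _ , m) → [ u ≐ z ] seq m n) shipments
      sum-row u = trans (sum-cong (seq-plan u) vertices)
        (trans (sum-swap (λ v (z , w , m) → [ u ≐ z ] [ v ≐ w ] seq m n) vertices shipments)
               (sum-cong (λ (z , w , m) → []-sum (u ≟ z) w (seq m n)) shipments))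

      sum-column : ∀ v → sum (λ u → seq (plan u v) n) vertices ≡
                   sum (λ (_ , w , m) → [ v ≐ w ] seq m n) shipments
      sum-column v = trans (sum-cong (λ u → seq-plan u v) vertices)
        (trans (sum-swap (λ u (z , w , m) → [ u ≐ z ] [ v ≐ w ] seq m n) vertices shipments)
               (sum-cong (λ (z , w , m) → trans
                  (sum-cong (λ u → []-swap (u ≟ z) (v ≟ w) (seq m n)) vertices)
                  ([]-sum (v ≟ w) z (seq m n))) shipments))

      -- The plan is a sum of point masses on pairs, so its cost collapses to one term per shipment.
      sum-weighted : (D : V → V → ℚ) →
                     sum (λ u → sum (λ v → D u v ℚ.* seq (plan u v) n) vertices) vertices ≡
                     sum (λ (z , w , m) → D z w ℚ.* seq m n) shipments
      sum-weighted D = begin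
        sum (λ u → sum (λ v → D u v ℚ.* seq (plan u v) n) vertices) vertices
          ≡⟨ sum-cong (λ u → sum-cong (λ v → trans (cong (D u v ℚ.*_) (seq-plan u v))
               (trans (sym (sum-*ˡ (D u v) (λ (z , w , m) → [ u ≐ z ] [ v ≐ w ] seq m n) shipments))
                 (sum-cong (λ (z , w , m) → *-[][] (u ≟ z) (v ≟ w) (D u v) (seq m n)) shipments)))
               vertices) vertices ⟩
        sum (λ u → sum (λ v → sum (λ s → term u v s) shipments) vertices) vertices
          ≡⟨ sum-cong (λ u → sum-swap (term u) vertices shipments) vertices ⟩
        sum (λ u → sum (λ s → sum (λ v → term u v s) vertices) shipments) vertices
          ≡⟨ sum-swap (λ u s → sum (λ v → term u v s) vertices) vertices shipments ⟩
        sum (λ s → sum (λ u → sum (λ v → term u v s) vertices) vertices) shipments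
          ≡⟨ sum-cong (λ (z , w , m) → trans
               (sum-cong (λ u → inner u z w (seq m n)) vertices)
               (sum-pointˡ (λ u → D u w ℚ.* seq m n) z)) shipments ⟩
        sum (λ (z , w , m) → D z w ℚ.* seq m n) shipments ∎
        where
        open ≡-Reasoning
        term : V → V → V × V × ℝ → ℚ
        term u v (z , w , m) = [ u ≐ z ] [ v ≐ w ] D u v ℚ.* seq m n
        inner : ∀ u z w c → sum (λ v → [ u ≐ z ] [ v ≐ w ] D u v ℚ.* c) vertices ≡
                [ u ≐ z ] D u w ℚ.* c
        inner u z w c = trans (sum-cong (λ v → []-swap (u ≟ z) (v ≟ w) (D u v ℚ.* c)) vertices)
                              (sum-pointˡ (λ v → [ u ≐ z ] D u v ℚ.* c) w)

      open +-*-Solver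

      -- The two shipments leaving `x` recombine, β + (α - β) = α, and every neighbour sends β. This
      -- is an identity at each index; bounds on α enter only for the signs.
      rowˡ : ∀ u → sum (λ (z , _ , m) → [ u ≐ z ] seq m n) shipments ≡ seq (μ G x α u) n
      rowˡ u = begin
        ([ u ≐ x ] b) ℚ.+ (([ u ≐ x ] (a ℚ.- b)) ℚ.+ (([ u ≐ y ] b) ℚ.+
          sum (λ (z , _ , m) → [ u ≐ z ] seq m n) (map (λ (z , w , _) → z , w , β) matched)))
          ≡⟨ cong (λ s → ([ u ≐ x ] b) ℚ.+ (([ u ≐ x ] (a ℚ.- b)) ℚ.+ (([ u ≐ y ] b) ℚ.+ s)))
               (trans (sum-map (λ (z , _ , m) → [ u ≐ z ] seq m n) (λ (z , w , _) → z , w , β) matched)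
                      (sym (sum-map (λ z → [ u ≐ z ] b) proj₁ matched))) ⟩
        ([ u ≐ x ] b) ℚ.+ (([ u ≐ x ] (a ℚ.- b)) ℚ.+ sum (λ z → [ u ≐ z ] b) (y ∷ map proj₁ matched))
          ≡⟨ trans (sym (ℚ.+-assoc ([ u ≐ x ] b) ([ u ≐ x ] (a ℚ.- b)) _))
               (cong (ℚ._+ sum (λ z → [ u ≐ z ] b) (y ∷ map proj₁ matched))
                 (trans (sym ([]-+ (u ≟ x) b (a ℚ.- b))) (cong ([ u ≐ x ]_) (b+[a-b]≡a a b)))) ⟩
        ([ u ≐ x ] a) ℚ.+ sum (λ z → [ u ≐ z ] b) (y ∷ map proj₁ matched)
          ≡⟨ seq-μ nbrsˡ (cong suc (trans (length-map proj₁ matched) four)) α u n ⟨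
        seq (μ G x α u) n ∎
        where
        open ≡-Reasoning
        b+[a-b]≡a : ∀ a b → b ℚ.+ (a ℚ.- b) ≡ a
        b+[a-b]≡a = solve 2 (λ a b → b :+ (a :- b) := a) refl

      columnʳ : ∀ v → sum (λ (_ , w , m) → [ v ≐ w ] seq m n) shipments ≡ seq (μ G y α v) n
      columnʳ v = begin
        ([ v ≐ x ] b) ℚ.+ (([ v ≐ y ] (a ℚ.- b)) ℚ.+ (([ v ≐ y ] b) ℚ.+
          sum (λ (_ , w , m) → [ v ≐ w ] seq m n) (map (λ (z , w , _) → z , w , β) matched)))
          ≡⟨ cong (λ s → ([ v ≐ x ] b) ℚ.+ (([ v ≐ y ] (a ℚ.- b)) ℚ.+ (([ v ≐ y ] b) ℚ.+ s)))
               (trans (sum-map (λ (_ , w , m) → [ v ≐ w ] seq m n) (λ (z , w , _) → z , w , β) matched)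
                      (sym (sum-map (λ w → [ v ≐ w ] b) (proj₁ ∘ proj₂) matched))) ⟩
        ([ v ≐ x ] b) ℚ.+ (([ v ≐ y ] (a ℚ.- b)) ℚ.+ (([ v ≐ y ] b) ℚ.+ rest))
          ≡⟨ reorder ([ v ≐ x ] b) ([ v ≐ y ] (a ℚ.- b)) ([ v ≐ y ] b) rest ⟩
        (([ v ≐ y ] (a ℚ.- b)) ℚ.+ ([ v ≐ y ] b)) ℚ.+ (([ v ≐ x ] b) ℚ.+ rest)
          ≡⟨ cong (ℚ._+ (([ v ≐ x ] b) ℚ.+ rest))
               (trans (sym ([]-+ (v ≟ y) (a ℚ.- b) b)) (cong ([ v ≐ y ]_) (a-b+b≡a a b))) ⟩
        ([ v ≐ y ] a) ℚ.+ (([ v ≐ x ] b) ℚ.+ rest)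
          ≡⟨ seq-μ nbrsʳ (cong suc (trans (length-map (proj₁ ∘ proj₂) matched) four)) α v n ⟨
        seq (μ G y α v) n ∎
        where
        open ≡-Reasoning
        rest : ℚ
        rest = sum (λ w → [ v ≐ w ] b) (map (proj₁ ∘ proj₂) matched)
        reorder : ∀ p q r s → p ℚ.+ (q ℚ.+ (r ℚ.+ s)) ≡ (q ℚ.+ r) ℚ.+ (p ℚ.+ s)
        reorder = solve 4 (λ p q r s → p :+ (q :+ (r :+ s)) := (q :+ r) :+ (p :+ s)) refl
        a-b+b≡a : ∀ a b → a ℚ.- b ℚ.+ b ≡ a
        a-b+b≡a = solve 2 (λ a b → a :- b :+ b := a) refl

      a+5b≡1 : a ℚ.+ ι 5 ℚ.* b ≡ 1ℚ
      a+5b≡1 = solve 1 (λ a → a :+ con (ι 5) :* ((con 1ℚ :- a) :* con (ℤ.+ 1 ℚ./ 5)) := con 1ℚ) refl a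

      -- The gain is (α - β) from the rise along the edge plus 6β from the matched pairs, that is α
      -- + 5β = 1.
      potential-gain : sum (λ v → ι (height v) ℚ.* seq (μ G y α v) n) vertices ≡
                       1ℚ ℚ.+ sum (λ v → ι (height v) ℚ.* seq (μ G x α v) n) vertices
      potential-gain = begin
        sum (λ v → ι (height v) ℚ.* seq (μ G y α v) n) vertices
          ≡⟨ sum-*-μ nbrsʳ (cong suc (trans (length-map (proj₁ ∘ proj₂) matched) four)) α (ι ∘ height) n ⟩
        ι (height y) ℚ.* a ℚ.+ (ι (height x) ℚ.+ sum (ι ∘ height) (map (proj₁ ∘ proj₂) matched)) ℚ.* b
          ≡⟨ cong₂ (λ p q → p ℚ.* a ℚ.+ (ι (height x) ℚ.+ q) ℚ.* b)
               ιy (trans (sum-map (ι ∘ height) (proj₁ ∘ proj₂) matched)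
                    (trans (sum-ι (height ∘ proj₁ ∘ proj₂) matched) (trans (cong ι drop) (ι-+ 6 S)))) ⟩
        (1ℚ ℚ.+ ι (height x)) ℚ.* a ℚ.+ (ι (height x) ℚ.+ (ι 6 ℚ.+ ι S)) ℚ.* b
          ≡⟨ algebra (ι (height x)) a b (ι S) ⟩
        (a ℚ.+ ι 5 ℚ.* b) ℚ.+ (ι (height x) ℚ.* a ℚ.+ ((1ℚ ℚ.+ ι (height x)) ℚ.+ ι S) ℚ.* b)
          ≡⟨ cong₂ ℚ._+_ a+5b≡1 (cong₂ (λ p q → ι (height x) ℚ.* a ℚ.+ (p ℚ.+ q) ℚ.* b)
               (sym ιy) (sym (trans (sum-map (ι ∘ height) proj₁ matched)
                                     (sum-ι (height ∘ proj₁) matched)))) ⟩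
        1ℚ ℚ.+ (ι (height x) ℚ.* a ℚ.+ (ι (height y) ℚ.+ sum (ι ∘ height) (map proj₁ matched)) ℚ.* b)
          ≡⟨ cong (1ℚ ℚ.+_)
               (sum-*-μ nbrsˡ (cong suc (trans (length-map proj₁ matched) four)) α (ι ∘ height) n) ⟨
        1ℚ ℚ.+ sum (λ v → ι (height v) ℚ.* seq (μ G x α v) n) vertices ∎
        where
        open ≡-Reasoning
        S : ℕ
        S = foldr (λ (z , _ , _) s → height z ℕ.+ s) 0 matched
        ιy : ι (height y) ≡ 1ℚ ℚ.+ ι (height x)
        ιy = trans (cong ι rise) (ι-+ 1 (height x))
        algebra : ∀ h a b s → (1ℚ ℚ.+ h) ℚ.* a ℚ.+ (h ℚ.+ (ι 6 ℚ.+ s)) ℚ.* b ≡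
                  (a ℚ.+ ι 5 ℚ.* b) ℚ.+ (h ℚ.* a ℚ.+ ((1ℚ ℚ.+ h) ℚ.+ s) ℚ.* b)
        algebra = solve 4 (λ h a b s →
          (con 1ℚ :+ h) :* a :+ (h :+ (con (ι 6) :+ s)) :* b :=
          (a :+ con (ι 5) :* b) :+ (h :* a :+ ((con 1ℚ :+ h) :+ s) :* b)) refl

      module _ (½≤a : ℚ.½ ℚ.≤ a) (a≤1 : a ℚ.≤ 1ℚ) where

        0≤b : 0ℚ ℚ.≤ b
        0≤b = ℚ.*-monoʳ-≤-nonNeg (ℤ.+ 1 ℚ./ 5) {0ℚ} {1ℚ ℚ.- a}
          (subst (ℚ._≤ 1ℚ ℚ.- a) (ℚ.+-inverseʳ a) (ℚ.+-monoˡ-≤ (ℚ.- a) a≤1))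

        0≤a-b : 0ℚ ℚ.≤ a ℚ.- b
        0≤a-b = subst (ℚ._≤ a ℚ.- b) (ℚ.+-inverseʳ b) (ℚ.+-monoˡ-≤ (ℚ.- b) (begin
          b                                    ≤⟨ ℚ.*-monoʳ-≤-nonNeg (ℤ.+ 1 ℚ./ 5)
                                                    (ℚ.+-monoʳ-≤ 1ℚ (ℚ.neg-antimono-≤ ½≤a)) ⟩
          -- This is 1/10 ≤ 1/2, cross-multiplied to 2 ≤ 10.
          (1ℚ ℚ.- ℚ.½) ℚ.* (ℤ.+ 1 ℚ./ 5)       ≤⟨ ℚ.toℚᵘ-cancel-≤ (ℚᵘ.*≤* (ℤ.+≤+ (ℕ.m≤m+n 2 8))) ⟩
          ℚ.½                                  ≤⟨ ½≤a ⟩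
          a                                    ∎))
          where open ℚ.≤-Reasoning

        masses≥0 : All (λ (_ , _ , m) → 0ℚ ℚ.≤ seq m n) shipments
        masses≥0 = 0≤b ∷ 0≤a-b ∷ 0≤b ∷ All.map⁺ (All.universal (λ _ → 0≤b) matched)

        mass≡1 : sum (λ (_ , _ , m) → seq m n) shipments ≡ 1ℚ
        mass≡1 = trans
          (cong (λ s → b ℚ.+ ((a ℚ.- b) ℚ.+ (b ℚ.+ s)))
            (trans (sum-map (λ (_ , _ , m) → seq m n) (λ (z , w , _) → z , w , β) matched)
              (trans (sum-const b matched) (cong (λ l → ι l ℚ.* b) four))))
          (trans (collect a b) a+5b≡1)
          where
          collect : ∀ a b → b ℚ.+ ((a ℚ.- b) ℚ.+ (b ℚ.+ ι 4 ℚ.* b)) ≡ a ℚ.+ ι 5 ℚ.* b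
          collect = solve 2 (λ a b → b :+ ((a :- b) :+ (b :+ con (ι 4) :* b)) := a :+ con (ι 5) :* b) refl

        plan≥0 : ∀ u v → 0ℚ ℚ.≤ seq (plan u v) n
        plan≥0 u v = begin
          0ℚ  ≡⟨ sum-zero shipments ⟨
          sum (λ _ → 0ℚ) shipments
              ≤⟨ sum-mono (All.map (λ {(z , w , _)} 0≤m → []-≥0 (u ≟ z) ([]-≥0 (v ≟ w) 0≤m)) masses≥0) ⟩
          sum (λ (z , w , m) → [ u ≐ z ] [ v ≐ w ] seq m n) shipments
              ≡⟨ seq-plan u v ⟨
          seq (plan u v) n ∎
          where open ℚ.≤-Reasoning

        plan≤1 : ∀ u v → seq (plan u v) n ℚ.≤ 1ℚ
        plan≤1 u v = begin
          seq (plan u v) n  ≡⟨ seq-plan u v ⟩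
          sum (λ (z , w , m) → [ u ≐ z ] [ v ≐ w ] seq m n) shipments
              ≤⟨ sum-mono (All.map (λ {(z , w , _)} 0≤m →
                   ℚ.≤-trans ([]-≤ (u ≟ z) ([]-≥0 (v ≟ w) 0≤m)) ([]-≤ (v ≟ w) 0≤m)) masses≥0) ⟩
          sum (λ (_ , _ , m) → seq m n) shipments ≡⟨ mass≡1 ⟩
          1ℚ ∎
          where open ℚ.≤-Reasoning

        module _ (conn : Graph.Connected G) where

          dist*≤ : ∀ {u v k c} → Walk u v k → 0ℚ ℚ.≤ c →
                   ι (dist G conn u v) ℚ.* c ℚ.≤ ι k ℚ.* c
          dist*≤ {c = c} w 0≤c = ℚ.*-monoʳ-≤-nonNeg c {{ℚ.nonNegative 0≤c}} (ι-mono (dist≤ conn w))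

          cost≤1 : seq (cost G conn plan) n ℚ.≤ 1ℚ
          cost≤1 = begin
            seq (cost G conn plan) n
              ≡⟨ trans (seq-∑ (λ u → ∑ G λ v → fromℕ (dist G conn u v) * plan u v) n)
                   (sum-cong (λ u → seq-∑ (λ v → fromℕ (dist G conn u v) * plan u v) n) vertices) ⟩
            sum (λ u → sum (λ v → ι (dist G conn u v) ℚ.* seq (plan u v) n) vertices) vertices
              ≡⟨ sum-weighted (λ u v → ι (dist G conn u v)) ⟩
            sum (λ (z , w , m) → ι (dist G conn z w) ℚ.* seq m n) shipments
              ≤⟨ ℚ.+-mono-≤ (dist*≤ {x} {x} [] 0≤b) (ℚ.+-mono-≤ (dist*≤ {x} {y} (x∼y ∷ []) 0≤a-b)
                   (ℚ.+-mono-≤ (dist*≤ {y} {y} [] 0≤b)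
                     (ℚ.≤-trans (ℚ.≤-reflexive (sum-map (λ (z , w , m) → ι (dist G conn z w) ℚ.* seq m n)
                                                        (λ (z , w , _) → z , w , β) matched))
                       (sum-mono (All.map (λ w → dist*≤ w 0≤b) walks))))) ⟩
            ι 0 ℚ.* b ℚ.+ (ι 1 ℚ.* (a ℚ.- b) ℚ.+ (ι 0 ℚ.* b ℚ.+ sum (λ (_ , _ , k) → ι k ℚ.* b) matched))
              ≡⟨ cong (λ s → ι 0 ℚ.* b ℚ.+ (ι 1 ℚ.* (a ℚ.- b) ℚ.+ (ι 0 ℚ.* b ℚ.+ s)))
                   (trans (sum-*ʳ b (λ (_ , _ , k) → ι k) matched)
                     (cong (ℚ._* b) (trans (sum-ι (λ (_ , _ , k) → k) matched) (cong ι cost≡6)))) ⟩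
            ι 0 ℚ.* b ℚ.+ (ι 1 ℚ.* (a ℚ.- b) ℚ.+ (ι 0 ℚ.* b ℚ.+ ι 6 ℚ.* b))
              ≡⟨ collect a b ⟩
            a ℚ.+ ι 5 ℚ.* b
              ≡⟨ a+5b≡1 ⟩
            1ℚ ∎
            where
            open ℚ.≤-Reasoning
            x∼y : Adj x y
            x∼y = All.head (sound nbrsˡ)
            collect : ∀ a b → ι 0 ℚ.* b ℚ.+ (ι 1 ℚ.* (a ℚ.- b) ℚ.+ (ι 0 ℚ.* b ℚ.+ ι 6 ℚ.* b)) ≡
                      a ℚ.+ ι 5 ℚ.* b
            collect = solve 2 (λ a b → con (ι 0) :* b :+ (con (ι 1) :* (a :- b) :+
              (con (ι 0) :* b :+ con (ι 6) :* b)) := a :+ con (ι 5) :* b) refl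

    module _ (conn : Graph.Connected G)
             (bounds : ∃ λ N → ∀ n → N ℕ.≤ n → ℚ.½ ℚ.≤ seq α n × seq α n ℚ.≤ 1ℚ) where

      private
        N = proj₁ bounds
        ½≤ : ∀ n → N ℕ.≤ n → ℚ.½ ℚ.≤ seq α n
        ½≤ n N≤n = proj₁ (proj₂ bounds n N≤n)
        ≤1 : ∀ n → N ℕ.≤ n → seq α n ℚ.≤ 1ℚ
        ≤1 n N≤n = proj₂ (proj₂ bounds n N≤n)

      plan-valid : IsTransportPlan G (μ G x α) (μ G y α) plan
      plan-valid = record
        { nonNegative = λ u v → termwise-≤ {0ℝ} {plan u v} (N , λ n N≤n →
            plan≥0 n (½≤ n N≤n) (≤1 n N≤n) u v)
        ; atMostOne   = λ u v → termwise-≤ {plan u v} {1ℝ} (N , λ n N≤n →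
            plan≤1 n (½≤ n N≤n) (≤1 n N≤n) u v)
        ; marginalˡ   = λ u → termwise-≈ {∑ G (λ v → plan u v)} {μ G x α u} λ n →
            trans (seq-∑ (λ v → plan u v) n) (trans (sum-row n u) (rowˡ n u))
        ; marginalʳ   = λ v → termwise-≈ {∑ G (λ u → plan u v)} {μ G y α v} λ n →
            trans (seq-∑ (λ u → plan u v) n) (trans (sum-column n v) (columnʳ n v))
        }

      1≤cost : ∀ π → IsTransportPlan G (μ G x α) (μ G y α) π → 1ℝ ≤ cost G conn π
      1≤cost π isPlan = mk≤ λ ε 0<ε →
        let M , h = _≤_.eventually (duality conn height lipschitz {π = π} isPlan) ε 0<ε
        in M , λ n M≤n → cancel n (h n M≤n)
        where
        weighted : (V → ℝ) → ℝ
        weighted ρ = ∑ G (λ v → fromℕ (height v) * ρ v)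
        cancel : ∀ n {ε} → seq (weighted (μ G y α)) n ℚ.≤
                 seq (cost G conn π) n ℚ.+ seq (weighted (μ G x α)) n ℚ.+ ε →
                 1ℚ ℚ.≤ seq (cost G conn π) n ℚ.+ ε
        cancel n {ε} h = begin
          1ℚ                                  ≡⟨ add-sub 1ℚ S ⟩
          1ℚ ℚ.+ S ℚ.- S                      ≡⟨ cong (ℚ._- S) (trans (cong (1ℚ ℚ.+_) (seq-∑ _ n))
                                                   (trans (sym (potential-gain n)) (sym (seq-∑ _ n)))) ⟩
          seq (weighted (μ G y α)) n ℚ.- S    ≤⟨ ℚ.+-monoˡ-≤ (ℚ.- S) h ⟩
          C ℚ.+ S ℚ.+ ε ℚ.- S                 ≡⟨ cancel-middle C S ε ⟩
          C ℚ.+ ε ∎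
          where
          open ℚ.≤-Reasoning
          open +-*-Solver
          C S : ℚ
          C = seq (cost G conn π) n
          S = seq (weighted (μ G x α)) n
          add-sub : ∀ p q → p ≡ p ℚ.+ q ℚ.- q
          add-sub = solve 2 (λ p q → p := p :+ q :- q) refl
          cancel-middle : ∀ p q r → p ℚ.+ q ℚ.+ r ℚ.- q ≡ p ℚ.+ r
          cancel-middle = solve 3 (λ p q r → p :+ q :+ r :- q := p :+ r) refl

      W₁≡1 : IsW₁ G conn (μ G x α) (μ G y α) 1ℝ
      W₁≡1 = record
        { optimal   = plan
        ; isPlan    = plan-valid
        ; attained  = termwise-≤ {cost G conn plan} {1ℝ} (N , λ n N≤n →
                        cost≤1 n (½≤ n N≤n) (≤1 n N≤n) conn)
                    , 1≤cost plan plan-valid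
        ; isMinimum = 1≤cost
        }

  -- With δ = 1/2 the mass α - β is nonnegative and W₁ is 1, so κ_α is 0. The quotient is then 0
  -- times the inverse of 1 - α, which vanishes termwise whatever that inverse is.
  flat : (conn : Graph.Connected G) → ∀ {x y} → FlatEdge x y → IsLinLuYau G conn x y 0ℝ
  flat conn {x} {y} edge ε (mk< c 0<c K 0+c≤ε) =
    fromℚ ℚ.½ , mk< ℚ.½ (ℚ.positive⁻¹ ℚ.½) 0 (λ _ _ → ℚ.≤-refl) ,
    λ α _ ½<α α<1 →
      1ℝ - 1ℝ ,
      (1ℝ , Optimal.W₁≡1 edge α conn (bounds α ½<α α<1) ,
        termwise-≈ {1ℝ - 1ℝ} {1ℝ - 1ℝ} λ _ → refl) ,
      mk< c 0<c K (λ n → -ε<0 n (seq (inv (1ℝ - α) (x<y⇒0<y-x α<1)) n)) ,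
      mk< c 0<c K (λ n → 0<ε n (seq (inv (1ℝ - α) (x<y⇒0<y-x α<1)) n))
    where
    open ℚ.≤-Reasoning
    open +-*-Solver
    c≤ε : ∀ n → K ℕ.≤ n → c ℚ.≤ seq ε n
    c≤ε n K≤n = subst (ℚ._≤ seq ε n) (ℚ.+-identityˡ c) (0+c≤ε n K≤n)
    sub-add : ∀ q → 0ℚ ℚ.- q ℚ.+ q ≡ 0ℚ
    sub-add = solve 1 (λ q → con 0ℚ :- q :+ q := con 0ℚ) refl
    -ε<0 : ∀ n r → K ℕ.≤ n → 0ℚ ℚ.- seq ε n ℚ.+ c ℚ.≤ 0ℚ ℚ.* r
    -ε<0 n r K≤n = begin
      0ℚ ℚ.- seq ε n ℚ.+ c        ≤⟨ ℚ.+-monoʳ-≤ (0ℚ ℚ.- seq ε n) (c≤ε n K≤n) ⟩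
      0ℚ ℚ.- seq ε n ℚ.+ seq ε n  ≡⟨ sub-add (seq ε n) ⟩
      0ℚ                          ≡⟨ ℚ.*-zeroˡ r ⟨
      0ℚ ℚ.* r                    ∎
    0<ε : ∀ n r → K ℕ.≤ n → 0ℚ ℚ.* r ℚ.+ c ℚ.≤ 0ℚ ℚ.+ seq ε n
    0<ε n r K≤n = begin
      0ℚ ℚ.* r ℚ.+ c  ≡⟨ cong (ℚ._+ c) (ℚ.*-zeroˡ r) ⟩
      0ℚ ℚ.+ c        ≤⟨ 0+c≤ε n K≤n ⟩
      seq ε n         ≡⟨ ℚ.+-identityˡ (seq ε n) ⟨
      0ℚ ℚ.+ seq ε n  ∎
    weaken : ∀ {p q g} → 0ℚ ℚ.< g → p ℚ.+ g ℚ.≤ q → p ℚ.≤ q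
    weaken {p} {q} {g} 0<g p+g≤q = ℚ.≤-trans
      (subst (ℚ._≤ p ℚ.+ g) (ℚ.+-identityʳ p) (ℚ.+-monoʳ-≤ p (ℚ.<⇒≤ 0<g))) p+g≤q
    bounds : ∀ α → 1ℝ - fromℚ ℚ.½ < α → α < 1ℝ →
             ∃ λ N → ∀ n → N ℕ.≤ n → ℚ.½ ℚ.≤ seq α n × seq α n ℚ.≤ 1ℚ
    bounds α (mk< g 0<g M below) (mk< g′ 0<g′ M′ above) = M ℕ.⊔ M′ , λ n ≤n →
      weaken {ℚ.½} {seq α n} {g} 0<g (below n (ℕ.m⊔n≤o⇒m≤o M M′ ≤n)) ,
      weaken {seq α n} {1ℚ} {g′} 0<g′ (above n (ℕ.m⊔n≤o⇒n≤o M M′ ≤n))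

-- Walks and automorphisms

module _ {G : Graph} where

  open Graph G

  _++ʷ_ : ∀ {x y z k l} → Walk x y k → Walk y z l → Walk x z (k ℕ.+ l)
  []      ++ʷ w′ = w′
  (a ∷ w) ++ʷ w′ = a ∷ (w ++ʷ w′)

  module _ (σ σ⁻¹ : V → V) (σσ⁻¹ : ∀ v → σ (σ⁻¹ v) ≡ v) (σ⁻¹σ : ∀ v → σ⁻¹ (σ v) ≡ v)
           (σ-adj : ∀ {u v} → Adj u v → Adj (σ u) (σ v))
           (σ⁻¹-adj : ∀ {u v} → Adj u v → Adj (σ⁻¹ u) (σ⁻¹ v)) where

    private
      map-walk : ∀ {u v k} → Walk u v k → Walk (σ u) (σ v) k
      map-walk []      = []
      map-walk (a ∷ w) = σ-adj a ∷ map-walk w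

      map-enumerates : ∀ {x L} → L enumerates Adj x → map σ L enumerates Adj (σ x)
      map-enumerates {x} {L} e = record
        { unique   = Unique.map⁺ (λ {u} {v} eq → trans (sym (σ⁻¹σ u)) (trans (cong σ⁻¹ eq) (σ⁻¹σ v)))
                                 (unique e)
        ; sound    = All.map⁺ (All.map σ-adj (sound e))
        ; complete = λ {v} a → subst (_∈ map σ L) (σσ⁻¹ v)
            (∈-map⁺ σ (complete e (subst (λ u → Adj u (σ⁻¹ v)) (σ⁻¹σ x) (σ⁻¹-adj a))))
        }

      foldr-map-cong : {A : Set} (τ : A → A) (k l : A → ℕ) → (∀ t → k (τ t) ≡ l t) → ∀ ts →
                       foldr (λ t s → k t ℕ.+ s) 0 (map τ ts) ≡ foldr (λ t s → l t ℕ.+ s) 0 ts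
      foldr-map-cong τ k l eq []       = refl
      foldr-map-cong τ k l eq (t ∷ ts) = cong₂ ℕ._+_ (eq t) (foldr-map-cong τ k l eq ts)

    transport : ∀ {x y} → FlatEdge G x y → FlatEdge G (σ x) (σ y)
    transport {x} {y} edge = record
      { matched   = map τ matched
      ; walks     = All.map⁺ (All.map map-walk walks)
      ; cost≡6    = trans (foldr-map-cong τ (proj₂ ∘ proj₂) (proj₂ ∘ proj₂) (λ _ → refl) matched) cost≡6
      ; four      = trans (length-map τ matched) four
      ; nbrsˡ     = subst (_enumerates Adj (σ x))
                      (cong (σ y ∷_) (trans (sym (map-∘ matched)) (map-∘ matched)))
                      (map-enumerates nbrsˡ)
      ; nbrsʳ     = subst (_enumerates Adj (σ y))
                      (cong (σ x ∷_) (trans (sym (map-∘ matched)) (map-∘ matched)))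
                      (map-enumerates nbrsʳ)
      ; height    = height ∘ σ⁻¹
      ; lipschitz = lipschitz ∘ σ⁻¹-adj
      ; rise      = trans (cong height (σ⁻¹σ y)) (trans rise (cong (suc ∘ height) (sym (σ⁻¹σ x))))
      ; drop      = trans (foldr-map-cong τ (height ∘ σ⁻¹ ∘ proj₁ ∘ proj₂) (height ∘ proj₁ ∘ proj₂)
                             (cong height ∘ σ⁻¹σ ∘ proj₁ ∘ proj₂) matched)
                      (trans drop (cong (6 ℕ.+_) (sym
                        (foldr-map-cong τ (height ∘ σ⁻¹ ∘ proj₁) (height ∘ proj₁)
                          (cong height ∘ σ⁻¹σ ∘ proj₁) matched))))
      }
      where
      open FlatEdge edge
      τ : V × V × ℕ → V × V × ℕ
      τ (z , w , k) = σ z , σ w , k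

    -- Every neighbour of `σ u` is the image of a neighbour of `u`, so flatness of all edges at a
    -- vertex moves along an automorphism.
    transport-all : ∀ {u} → (∀ {v} → Adj u v → FlatEdge G u v) → ∀ {v} → Adj (σ u) v → FlatEdge G (σ u) v
    transport-all {u} at {v} a = subst (FlatEdge G (σ u)) (σσ⁻¹ v)
      (transport (at (subst (λ w → Adj w (σ⁻¹ v)) (σ⁻¹σ u) (σ⁻¹-adj a))))

-- Edges of a Cartesian product

-- Lets an argument about the X-direction be repeated for the Y-direction: the swap turns `∥ʸ` into
-- `∥ˣ`.
□-swap : ∀ {G X Y} → G ≅ X □ Y → G ≅ Y □ X
□-swap {G} {X} {Y} ψ = record
  { bijection = ↔-trans bijection (mk↔ₛ′ (λ (a , b) → b , a) (λ (b , a) → a , b) (λ _ → refl) (λ _ → refl))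
  ; adjacency = λ u v → mk⇔ (swap ∘ Equivalence.to (adjacency u v))
                            (Equivalence.from (adjacency u v) ∘ swap)
  }
  where open _≅_ ψ

module _ {G X Y : Graph} (ψ : G ≅ X □ Y) where

  open Graph G using (V; Adj; irrefl; symm; Walk; []; _∷_)
  open _≅_ ψ
  open Inverse bijection using (strictlyInverseˡ; strictlyInverseʳ)

  -- Being parallel to X means having equal Y-coordinates, and conversely. Defined on arbitrary
  -- pairs rather than edges, the relations are transitive and can be chained along an orbit.
  _∥ˣ_ _∥ʸ_ : V → V → Set
  u ∥ˣ v = proj₂ (to u) ≡ proj₂ (to v)
  u ∥ʸ v = proj₁ (to u) ≡ proj₁ (to v)

  direction : ∀ {u v} → Adj u v → u ∥ˣ v ⊎ u ∥ʸ v
  direction {u} {v} a with Equivalence.to (adjacency u v) a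
  ... | inj₁ (eq , _) = inj₂ eq
  ... | inj₂ (eq , _) = inj₁ eq

  ∥-exclusive : ∀ {u v} → Adj u v → u ∥ˣ v → ¬ u ∥ʸ v
  ∥-exclusive {u} {v} a p q = irrefl (subst (Adj u) (sym u≡v) a)
    where
    u≡v : u ≡ v
    u≡v = trans (sym (strictlyInverseʳ u))
            (trans (cong from (cong₂ _,_ q p)) (strictlyInverseʳ v))

  OnlyCommon : V → V → V → Set
  OnlyCommon u v w = ∀ {t} → Adj v t → Adj w t → t ≡ u

  -- Two edges u – v and u – w in different directions span a square u, v, t, w.
  private
    corner : ∀ {u v w} → Adj u v → Adj u w → OnlyCommon u v w → u ∥ˣ v → ¬ u ∥ʸ w
    corner {u} {v} {w} uv uw only p q
      with Equivalence.to (adjacency u v) uv | Equivalence.to (adjacency u w) uw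
    ... | inj₁ (eq , _) | _             = ∥-exclusive uv p eq
    ... | inj₂ _        | inj₂ (eq , _) = ∥-exclusive uw eq q
    ... | inj₂ (_ , xy) | inj₁ (_ , yy) = irrefl {u} (subst (Adj u) t≡u ut)
      where
      t : V
      -- The fourth corner of the square: X-coordinate of `v`, Y-coordinate of `w`.
      t = from (proj₁ (to v) , proj₂ (to w))
      to-t : to t ≡ (proj₁ (to v) , proj₂ (to w))
      to-t = strictlyInverseˡ _
      t≡u : t ≡ u
      t≡u = only
        (Equivalence.from (adjacency v t) (subst (Graph.Adj (X □ Y) (to v)) (sym to-t)
          (inj₁ (refl , subst (λ b → Graph.Adj Y b (proj₂ (to w))) p yy))))
        (Equivalence.from (adjacency w t) (subst (Graph.Adj (X □ Y) (to w)) (sym to-t)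
          (inj₂ (refl , subst (λ a → Graph.Adj X a (proj₁ (to v))) q xy))))
      ut : Adj u t
      -- Obtained from a contradiction: if `t` were `u`, the X-edge from `u` to `v` would become a
      -- loop at the X-coordinate of `v`.
      ut = contradiction (subst (λ z → Graph.Adj X (proj₁ z) (proj₁ (to v))) (cong to (sym t≡u)) xy)
             (λ a → Graph.irrefl X (subst (λ z → Graph.Adj X (proj₁ z) (proj₁ (to v))) to-t a))

  ∥ˣ-corner : ∀ {u v w} → Adj u v → Adj u w → OnlyCommon u v w → u ∥ˣ v → u ∥ˣ w
  ∥ˣ-corner uv uw only p with direction uw
  ... | inj₁ q = q
  ... | inj₂ q = contradiction q (corner uv uw only p)

  ∥ʸ-corner : ∀ {u v w} → Adj u v → Adj u w → OnlyCommon u v w → u ∥ʸ v → u ∥ʸ w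
  ∥ʸ-corner uv uw only p with direction uw
  ... | inj₁ q = contradiction p (corner uw uv (λ a b → only b a) q)
  ... | inj₂ q = q

  open Graph Y using () renaming (V to VY; _≟_ to _≟ʸ_; Adj to AdjY; order to orderY; finite to finiteY)

  private
    another-index : ∀ {n} → 2 ℕ.≤ n → (i : Fin n) → ∃ (i ≢_)
    another-index (ℕ.s≤s (ℕ.s≤s _)) zero    = suc zero , λ ()
    another-index (ℕ.s≤s (ℕ.s≤s _)) (suc _) = zero , λ ()

    another : 2 ℕ.≤ orderY → (b : VY) → ∃ (b ≢_)
    another 2≤ b =
      let j , ≢j = another-index 2≤ (Inverse.to finiteY b)
      in Inverse.from finiteY j , λ b≡ →
           ≢j (trans (cong (Inverse.to finiteY) b≡) (Inverse.strictlyInverseˡ finiteY j))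

    -- A walk that changes the Y-coordinate must use a Y-edge, and before the first such edge the
    -- Y-coordinate is still that of `u`. Connectedness of `G` thus stands in for that of the
    -- factor.
    leaves : ∀ {u v k} → Walk u v k → ¬ u ∥ˣ v → ∃ (AdjY (proj₂ (to u)))
    leaves [] ¬p = contradiction refl ¬p
    leaves {u} (_∷_ {y = t} a w) ¬p with Equivalence.to (adjacency u t) a
    ... | inj₁ (_ , e) = _ , e
    ... | inj₂ (p , _) = subst (λ b → ∃ (AdjY b)) (sym p) (leaves w (¬p ∘ trans p))

  -- The Y-edge met along a walk may start at another X-coordinate; the product structure moves it
  -- back to `u`.
  edge∥ʸ : Graph.Connected G → 2 ℕ.≤ orderY → ∀ u → ∃ λ v → Adj u v × u ∥ʸ v
  edge∥ʸ conn 2≤ u =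
    let b′ , b≢b′ = another 2≤ (proj₂ (to u))
        w = from (proj₁ (to u) , b′)
        b″ , e = leaves (proj₂ (Graph.Connected.someWalk conn u w))
                        (λ p → b≢b′ (trans p (cong proj₂ (strictlyInverseˡ _))))
        v = from (proj₁ (to u) , b″)
        to-v = strictlyInverseˡ (proj₁ (to u) , b″)
    in v , Equivalence.from (adjacency u v)
             (subst (Graph.Adj (X □ Y) (to u)) (sym to-v) (inj₁ (refl , e))) ,
       cong proj₁ (sym to-v)

-- Twisted graphs

-- `orbit` says that `twist` lies on the forward `T`-orbit of `base`, as an induction principle, so
-- that no exponent appears.
record Twisted (G : Graph) : Set₁ where
  open Graph G
  field
    T T⁻¹         : V → V
    T⁻¹∘T         : ∀ v → T⁻¹ (T v) ≡ v
    Fibre         : V → V → Set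
    adj-T         : ∀ v → Adj v (T v)
    adj-T⁻¹       : ∀ v → Adj v (T⁻¹ v)
    adj-fibre     : ∀ {v w} → Fibre v w → Adj v w
    adj-cases     : ∀ {v w} → Adj v w → w ≡ T v ⊎ w ≡ T⁻¹ v ⊎ Fibre v w
    only-common-T : ∀ v {t} → Adj (T v) t → Adj (T⁻¹ v) t → t ≡ v
    only-common-fibre : ∀ {v w w′} → Fibre v w → Fibre v w′ → w ≢ w′ →
                        ∀ {t} → Adj w t → Adj w′ t → t ≡ v
    base twist    : V
    base∼twist    : Fibre base twist
    orbit         : (P : V → Set) → (∀ {v} → P v → P (T v)) → P base → P twist

module _ {G : Graph} (tw : Twisted G) (conn : Graph.Connected G) where

  open Graph G
  open Twisted tw

  -- If the edge from the base along T lies in the X-direction then so does the whole orbit,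
  -- which therefore has constant Y-coordinate; but it returns to a fibre neighbour of the base.
  ¬∥ˣ-T : ∀ {X Y} (ψ : G ≅ X □ Y) → 2 ℕ.≤ Graph.order Y → ¬ (_∥ˣ_ ψ base (T base))
  ¬∥ˣ-T ψ 2≤ p = ∥-exclusive ψ (adj-fibre base∼twist) (sym (proj₂ at-twist)) twist∥ʸ
    where
    _∥X_ _∥Y_ : V → V → Set
    _∥X_ = _∥ˣ_ ψ
    _∥Y_ = _∥ʸ_ ψ
    P : V → Set
    P v = v ∥X T v × v ∥X base
    step : ∀ {v} → P v → P (T v)
    step {v} (v∥Tv , v∥base) =
      -- The corner at `T v` between the edge back to `v` and the edge on to `T (T v)`: it spans no
      -- square, so the direction is inherited.
      ∥ˣ-corner ψ (adj-T⁻¹ (T v)) (adj-T (T v)) (λ a b → only-common-T (T v) b a)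
        (subst (T v ∥X_) (sym (T⁻¹∘T v)) (sym v∥Tv)) ,
      trans (sym v∥Tv) v∥base
    at-twist : P twist
    at-twist = orbit P step (p , refl)
    twist∥ʸ : base ∥Y twist
    -- Some edge at the base runs in the Y-direction. It is neither of the two `T`-edges, which both
    -- run in the X-direction, so it is a fibre edge; fibres have no squares, hence the edge to
    -- `twist` follows it.
    twist∥ʸ with edge∥ʸ ψ conn 2≤ base
    ... | w , a , q with adj-cases a
    ...   | inj₁ refl = contradiction q (∥-exclusive ψ a p)
    ...   | inj₂ (inj₁ refl) = contradiction
              (∥ʸ-corner ψ a (adj-T base) (λ a b → only-common-T base b a) q)
              (∥-exclusive ψ (adj-T base) p)
    ...   | inj₂ (inj₂ f) with w ≟ twist
    ...     | yes refl = q
    ...     | no w≢    = ∥ʸ-corner ψ a (adj-fibre base∼twist) (only-common-fibre f base∼twist w≢) q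

  twisted⇒¬product : ¬ CartesianProductType G
  twisted⇒¬product (X , Y , 2≤X , 2≤Y , ψ) with direction ψ (adj-T base)
  ... | inj₁ p = ¬∥ˣ-T ψ 2≤Y p
  ... | inj₂ p = ¬∥ˣ-T (□-swap {G} {X} {Y} ψ) 2≤X p

-- The Petersen graph: an outer pentagon 0–4, spokes p ∼ p + 5, and an inner pentagram 5–9.

nbr : Fin 10 → List (Fin 10)
nbr = Vec.lookup
  ( (1F ∷ 4F ∷ 5F ∷ []) ∷ (0F ∷ 2F ∷ 6F ∷ []) ∷ (1F ∷ 3F ∷ 7F ∷ [])
  ∷ (2F ∷ 4F ∷ 8F ∷ []) ∷ (3F ∷ 0F ∷ 9F ∷ [])
  ∷ (7F ∷ 8F ∷ 0F ∷ []) ∷ (8F ∷ 9F ∷ 1F ∷ []) ∷ (9F ∷ 5F ∷ 2F ∷ [])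
  ∷ (5F ∷ 6F ∷ 3F ∷ []) ∷ (6F ∷ 7F ∷ 4F ∷ []) ∷ [])

-- The reflection of the pentagon exchanging the adjacent vertices 0 and 1.
φ : Fin 10 → Fin 10
φ = Vec.lookup (1F ∷ 0F ∷ 4F ∷ 3F ∷ 2F ∷ 6F ∷ 5F ∷ 9F ∷ 8F ∷ 7F ∷ [])

module Label = DecMembership (Fin._≟_ {10})

φ-involutive : ∀ p → φ (φ p) ≡ p
φ-involutive = from-yes (Fin.all? λ p → φ (φ p) Fin.≟ p)

nbr-φ : ∀ p → All (λ q → φ q ∈ nbr (φ p)) (nbr p)
nbr-φ = from-yes (Fin.all? λ p → All.all? (λ q → φ q Label.∈? nbr (φ p)) (nbr p))

nbr-sym : ∀ p → All (λ q → p ∈ nbr q) (nbr p)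
nbr-sym = from-yes (Fin.all? λ p → All.all? (λ q → p Label.∈? nbr q) (nbr p))

nbr-irrefl : ∀ p → p ∉ nbr p
nbr-irrefl = from-yes (Fin.all? λ p → ¬? (p Label.∈? nbr p))

nbr-unique : ∀ p → Unique (nbr p)
nbr-unique = from-yes (Fin.all? λ p → DecUnique.unique? Fin._≟_ (nbr p))

length-nbr : ∀ p → length (nbr p) ≡ 3
length-nbr = from-yes (Fin.all? λ p → length (nbr p) ℕ.≟ 3)

-- Girth 5 excludes 4-cycles.
nbr-square-free : ∀ p → All (λ q → All (λ q′ → q ≢ q′ →
  All (λ r → r ∈ nbr q′ → r ≡ p) (nbr q)) (nbr p)) (nbr p)
nbr-square-free = from-yes (Fin.all? λ p → All.all? (λ q → All.all? (λ q′ →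
  ¬? (q Fin.≟ q′) →-dec All.all? (λ r → (r Label.∈? nbr q′) →-dec (r Fin.≟ p)) (nbr q)) (nbr p)) (nbr p))

nbr-diameter : ∀ p → p ≢ 0F → p ∉ nbr 0F → Any (λ q → p ∈ nbr q) (nbr 0F)
nbr-diameter = from-yes (Fin.all? λ p → ¬? (p Fin.≟ 0F) →-dec ¬? (p Label.∈? nbr 0F) →-dec
  Any.any? (λ q → p Label.∈? nbr q) (nbr 0F))

others : Fin 10 → Fin 10 → List (Fin 10)
others p q = filter (¬? ∘ (Fin._≟ q)) (nbr p)

-- Any pairing would do, so the order that `zip` happens to use is harmless: these vertices are
-- distinct and non-adjacent, and in the Petersen graph such vertices have a common neighbour.
others-joined : ∀ p → All (λ q → All (λ (r , s) → Any (λ t → s ∈ nbr t) (nbr r))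
                                     (zip (others p q) (others q p))) (nbr p)
others-joined = from-yes (Fin.all? λ p → All.all? (λ q → All.all?
  (λ (r , s) → Any.any? (λ t → s Label.∈? nbr t) (nbr r)) (zip (others p q) (others q p))) (nbr p))

-- The potential for the edge p – q; the value 1 elsewhere lets it be cut off by the constant 1
-- outside three consecutive levels.
petersen-height : Fin 10 → Fin 10 → Fin 10 → ℕ
petersen-height p q r =
  if does (r Label.∈? p ∷ others p q) then 0 else if does (r Label.∈? others q p) then 2 else 1

petersen-height≤2 : ∀ p q r → petersen-height p q r ℕ.≤ 2
petersen-height≤2 p q r with does (r Label.∈? p ∷ others p q) | does (r Label.∈? others q p)
... | true  | _     = ℕ.z≤n
... | false | true  = ℕ.≤-refl
... | false | false = ℕ.s≤s ℕ.z≤n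

petersen-lipschitz : ∀ p → All (λ q → ∀ r →
  All (λ s → petersen-height p q s ℕ.≤ suc (petersen-height p q r)) (nbr r)) (nbr p)
petersen-lipschitz = from-yes (Fin.all? λ p → All.all? (λ q → Fin.all? λ r →
  All.all? (λ s → petersen-height p q s ℕ.≤? suc (petersen-height p q r)) (nbr r)) (nbr p))

-- The cycle

next prev : ∀ {n} → Fin (suc n) → Fin (suc n)
next i with view i
... | ‵fromℕ     = zero
... | ‵inject₁ j = suc j
prev zero    = Fin.fromℕ _
prev (suc i) = inject₁ i

next-fromℕ : ∀ n → next (Fin.fromℕ n) ≡ zero
next-fromℕ n rewrite view-fromℕ n = refl

next-inject₁ : ∀ {n} (i : Fin n) → next (inject₁ i) ≡ suc i
next-inject₁ i rewrite view-inject₁ i = refl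

next-prev : ∀ {n} (i : Fin (suc n)) → next (prev i) ≡ i
next-prev zero    = next-fromℕ _
next-prev (suc i) = next-inject₁ i

prev-next : ∀ {n} (i : Fin (suc n)) → prev (next i) ≡ i
prev-next i with view i
... | ‵fromℕ     = refl
... | ‵inject₁ j = refl

next-injective : ∀ {n} {i j : Fin (suc n)} → next i ≡ next j → i ≡ j
next-injective {i = i} {j} eq = trans (sym (prev-next i)) (trans (cong prev eq) (prev-next j))

next-induction : ∀ {n} (P : Fin (suc n) → Set) → P zero → (∀ i → P i → P (next i)) → ∀ i → P i
next-induction P p₀ step = <-weakInduction P p₀ λ i p → subst P (next-inject₁ i) (step (inject₁ i) p)

-- The bundle

module Bundle (m : ℕ) where

  Level : Set
  Level = Fin (9 ℕ.+ m)

  fold-next-next : ∀ k (i : Level) → fold (next i) next k ≡ next (fold i next k)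
  fold-next-next zero    i = refl
  fold-next-next (suc k) i = cong next (fold-next-next k i)

  -- Rotational symmetry reduces the claim to `zero`. There the iterates used below, with k at most
  -- 4, compute to a successor because `9 + m` shows enough successors, so `λ ()` covers every `m`.
  next^-free : ∀ k → fold zero next k ≢ zero {8 ℕ.+ m} → ∀ (i : Level) → fold i next k ≢ i
  next^-free k ≢0 = next-induction (λ i → fold i next k ≢ i) ≢0 λ i ≢i eq →
    ≢i (next-injective (trans (sym (fold-next-next k i)) eq))

  next≢ : ∀ i → next i ≢ i
  next≢ = next^-free 1 λ ()

  prev≢ : ∀ i → prev i ≢ i
  prev≢ i eq = next≢ i (trans (cong next (sym eq)) (next-prev i))

  next≢prev : ∀ i → next i ≢ prev i
  next≢prev i eq = next^-free 2 (λ ()) i (trans (cong next eq) (next-prev i))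

  next²≢prev : ∀ i → next (next i) ≢ prev i
  next²≢prev i eq = next^-free 3 (λ ()) i (trans (cong next eq) (next-prev i))

  next≢prev² : ∀ i → next i ≢ prev (prev i)
  next≢prev² i eq = next^-free 3 (λ ()) i
    (trans (cong (next ∘ next) eq) (trans (cong next (next-prev (prev i))) (next-prev i)))

  next²≢prev² : ∀ i → next (next i) ≢ prev (prev i)
  next²≢prev² i eq = next^-free 4 (λ ()) i
    (trans (cong (next ∘ next) eq) (trans (cong next (next-prev (prev i))) (next-prev i)))

  Vertex : Set
  Vertex = Fin 10 × Level

  T T⁻¹ : Vertex → Vertex
  T   (p , i) = φ p , next i
  T⁻¹ (p , i) = φ p , prev i

  T∘T⁻¹ : ∀ v → T (T⁻¹ v) ≡ v
  T∘T⁻¹ (p , i) = cong₂ _,_ (φ-involutive p) (next-prev i)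

  T⁻¹∘T : ∀ v → T⁻¹ (T v) ≡ v
  T⁻¹∘T (p , i) = cong₂ _,_ (φ-involutive p) (prev-next i)

  neighbours : Vertex → List Vertex
  neighbours (p , i) = T (p , i) ∷ T⁻¹ (p , i) ∷ map (_, i) (nbr p)

  data _∼_ : Vertex → Vertex → Set where
    up    : ∀ {v} → v ∼ T v
    down  : ∀ {v} → v ∼ T⁻¹ v
    fibre : ∀ {p q i} → q ∈ nbr p → (p , i) ∼ (q , i)

  ∼⇒∈ : ∀ {u v} → u ∼ v → v ∈ neighbours u
  ∼⇒∈ up        = here refl
  ∼⇒∈ down      = there (here refl)
  ∼⇒∈ (fibre e) = there (there (∈-map⁺ _ e))

  ∈⇒∼ : ∀ {u v} → v ∈ neighbours u → u ∼ v
  ∈⇒∼ (here refl)         = up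
  ∈⇒∼ (there (here refl)) = down
  ∈⇒∼ (there (there e)) with _ , q∈ , refl ← ∈-map⁻ _ e = fibre q∈

  ∼-sym : ∀ {u v} → u ∼ v → v ∼ u
  ∼-sym {u} up   = subst (T u ∼_) (T⁻¹∘T u) down
  ∼-sym {u} down = subst (T⁻¹ u ∼_) (T∘T⁻¹ u) up
  ∼-sym (fibre {p} e) = fibre (All.lookup (nbr-sym p) e)

  T-∼ : ∀ {u v} → u ∼ v → T u ∼ T v
  T-∼ up            = up
  T-∼ {u} down      = subst (T u ∼_) (trans (T⁻¹∘T u) (sym (T∘T⁻¹ u))) down
  T-∼ (fibre {p} e) = fibre (All.lookup (nbr-φ p) e)

  T⁻¹-∼ : ∀ {u v} → u ∼ v → T⁻¹ u ∼ T⁻¹ v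
  T⁻¹-∼ {u} up        = subst (T⁻¹ u ∼_) (trans (T∘T⁻¹ u) (sym (T⁻¹∘T u))) up
  T⁻¹-∼ down          = down
  T⁻¹-∼ (fibre {p} e) = fibre (All.lookup (nbr-φ p) e)

  ∼⇒≢ : ∀ {u v} → u ∼ v → u ≢ v
  ∼⇒≢ (up {p , i})   eq = next≢ i (sym (cong proj₂ eq))
  ∼⇒≢ (down {p , i}) eq = prev≢ i (sym (cong proj₂ eq))
  ∼⇒≢ (fibre {p} e)  eq = nbr-irrefl p (subst (_∈ nbr p) (sym (cong proj₁ eq)) e)

  module Vertices = DecMembership (≡-dec (Fin._≟_ {10}) (Fin._≟_ {9 ℕ.+ m}))

  graph : Graph
  graph = record
    { V      = Vertex
    ; order  = 10 ℕ.* (9 ℕ.+ m)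
    ; finite = ↔-sym Fin.*↔×
    ; Adj    = _∼_
    ; adj?   = λ u v → map′ ∈⇒∼ ∼⇒∈ (v Vertices.∈? neighbours u)
    ; irrefl = λ a → ∼⇒≢ a refl
    ; symm   = ∼-sym
    }

  open Graph graph using (Walk; []; _∷_)

  -- Regularity and connectedness of the bundle

  neighbours-unique : ∀ v → Unique (neighbours v)
  neighbours-unique (p , i) =
    ((next≢prev i ∘ cong proj₂) ∷ All.map⁺ (universal (λ _ → next≢ i ∘ cong proj₂) (nbr p))) ∷
    All.map⁺ (universal (λ _ → prev≢ i ∘ cong proj₂) (nbr p)) ∷
    Unique.map⁺ (cong proj₁) (nbr-unique p)

  neighbours-enumerate : ∀ v → neighbours v enumerates (v ∼_)
  neighbours-enumerate v = record
    { unique = neighbours-unique v ; sound = All.tabulate ∈⇒∼ ; complete = ∼⇒∈ }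

  regular : Regular 5 graph
  regular v@(p , i) = trans (degree≡length graph v (neighbours-enumerate v))
    (cong (2 ℕ.+_) (trans (length-map (_, i) (nbr p)) (length-nbr p)))

  connected : Graph.Connected graph
  connected = record
    { someVertex = 0F , zero
    ; someWalk   = λ u v → let _ , w = from-origin u ; _ , w′ = from-origin v
                           in _ , _++ʷ_ {graph} (proj₂ (reverse w)) w′
    }
    where
    reverse : ∀ {u v k} → Walk u v k → ∃ (Walk v u)
    reverse []      = _ , []
    reverse (a ∷ w) = _ , _++ʷ_ {graph} (proj₂ (reverse w)) (∼-sym a ∷ [])
    in-fibre : ∀ p → ∃ (Walk (0F , zero) (p , zero))
    in-fibre p with p Fin.≟ 0F | p Label.∈? nbr 0F
    ... | yes refl | _     = _ , []
    ... | no _     | yes e = _ , (fibre e ∷ [])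
    ... | no p≢0   | no ¬e with q , q∈ , p∈ ← find (nbr-diameter p p≢0 ¬e)
      = _ , (fibre q∈ ∷ fibre p∈ ∷ [])
    from-origin : ∀ v → ∃ (Walk (0F , zero) v)
    from-origin (p , i) = next-induction (λ i → ∀ p → ∃ (Walk (0F , zero) (p , i))) in-fibre
      (λ i reach p → let _ , w = reach (φ p) in _ , _++ʷ_ {graph} w
        (subst (λ q → (φ p , i) ∼ (q , next i)) (φ-involutive p) up ∷ [])) i p

  -- Common neighbours in the bundle

  data Fibre : Vertex → Vertex → Set where
    fib : ∀ {p q i} → q ∈ nbr p → Fibre (p , i) (q , i)

  ∼-cases : ∀ {v w} → v ∼ w → w ≡ T v ⊎ w ≡ T⁻¹ v ⊎ Fibre v w
  ∼-cases up        = inj₁ refl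
  ∼-cases down      = inj₂ (inj₁ refl)
  ∼-cases (fibre e) = inj₂ (inj₂ (fib e))

  fibre-level : ∀ {v w} → Fibre v w → proj₂ w ≡ proj₂ v
  fibre-level (fib _) = refl

  -- Levels decide: the neighbours of `T v` lie on levels i, i + 1, i + 2 and those of `T⁻¹ v` on i
  -- - 2, i - 1, i. On so long a cycle only level i is shared, and there `v` is the sole candidate.
  only-common-T : ∀ v {t} → T v ∼ t → T⁻¹ v ∼ t → t ≡ v
  only-common-T v@(p , i) a b with ∼-cases a | ∼-cases b
  ... | _                | inj₁ t≡v         = trans t≡v (T∘T⁻¹ v)
  ... | inj₂ (inj₁ t≡v)  | _                = trans t≡v (T⁻¹∘T v)
  ... | inj₁ refl        | inj₂ (inj₁ eq)   = contradiction (cong proj₂ eq) (next²≢prev² i)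
  ... | inj₁ refl        | inj₂ (inj₂ f)    = contradiction (fibre-level f) (next²≢prev i)
  ... | inj₂ (inj₂ f)    | inj₂ (inj₁ refl) = contradiction (sym (fibre-level f)) (next≢prev² i)
  ... | inj₂ (inj₂ f)    | inj₂ (inj₂ f′)   =
    contradiction (trans (sym (fibre-level f)) (fibre-level f′)) (next≢prev i)

  -- A common neighbour on an adjacent level would contradict injectivity of `T` or `T⁻¹`; one on
  -- the same level would close a 4-cycle in the Petersen graph.
  only-common-fibre : ∀ {v w w′} → Fibre v w → Fibre v w′ → w ≢ w′ →
                      ∀ {t} → w ∼ t → w′ ∼ t → t ≡ v
  only-common-fibre {p , i} {w} {w′} (fib q∈) (fib q′∈) w≢w′ a b with ∼-cases a | ∼-cases b
  ... | inj₁ t≡Tw          | inj₁ t≡Tw′         = contradiction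
    (trans (sym (T⁻¹∘T w)) (trans (cong T⁻¹ (trans (sym t≡Tw) t≡Tw′)) (T⁻¹∘T w′))) w≢w′
  ... | inj₂ (inj₁ t≡T⁻¹w) | inj₂ (inj₁ t≡T⁻¹w′) = contradiction
    (trans (sym (T∘T⁻¹ w)) (trans (cong T (trans (sym t≡T⁻¹w) t≡T⁻¹w′)) (T∘T⁻¹ w′))) w≢w′
  ... | inj₁ refl          | inj₂ (inj₁ eq)     = contradiction (cong proj₂ eq) (next≢prev i)
  ... | inj₂ (inj₁ refl)   | inj₁ eq            = contradiction (sym (cong proj₂ eq)) (next≢prev i)
  ... | inj₁ refl          | inj₂ (inj₂ f)      = contradiction (fibre-level f) (next≢ i)
  ... | inj₂ (inj₂ f)      | inj₁ refl          = contradiction (fibre-level f) (next≢ i)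
  ... | inj₂ (inj₁ refl)   | inj₂ (inj₂ f)      = contradiction (fibre-level f) (prev≢ i)
  ... | inj₂ (inj₂ f)      | inj₂ (inj₁ refl)   = contradiction (fibre-level f) (prev≢ i)
  ... | inj₂ (inj₂ (fib r∈)) | inj₂ (inj₂ (fib r∈′)) = cong (_, i)
    (All.lookup (All.lookup (All.lookup (nbr-square-free p) q∈) q′∈ (w≢w′ ∘ cong (_, i))) r∈ r∈′)

  -- Certificates for the edges at level 2, whose neighbourhoods stay clear of the seam of the cycle.

  Valid : Vertex → Vertex → List (Vertex × Vertex × ℕ) → (Vertex → ℕ) → Set
  Valid x y ms h =
    foldr (λ (_ , _ , k) s → k ℕ.+ s) 0 ms ≡ 6 ×
    length ms ≡ 4 ×
    Lists x (y ∷ map proj₁ ms) ×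
    Lists y (x ∷ map (proj₁ ∘ proj₂) ms) ×
    h y ≡ suc (h x) ×
    foldr (λ (_ , w , _) s → h w ℕ.+ s) 0 ms ≡ 6 ℕ.+ foldr (λ (z , _ , _) s → h z ℕ.+ s) 0 ms
    where
    Lists : Vertex → List Vertex → Set
    Lists v L = Unique L × All (_∈ neighbours v) L × All (_∈ L) (neighbours v)

  valid? : ∀ x y ms h → Dec (Valid x y ms h)
  valid? x y ms h =
    foldr (λ (_ , _ , k) s → k ℕ.+ s) 0 ms ℕ.≟ 6 ×-dec
    length ms ℕ.≟ 4 ×-dec
    lists? x (y ∷ map proj₁ ms) ×-dec
    lists? y (x ∷ map (proj₁ ∘ proj₂) ms) ×-dec
    h y ℕ.≟ suc (h x) ×-dec
    foldr (λ (_ , w , _) s → h w ℕ.+ s) 0 ms ℕ.≟ 6 ℕ.+ foldr (λ (z , _ , _) s → h z ℕ.+ s) 0 ms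
    where
    lists? : ∀ v L → Dec (Unique L × All (_∈ neighbours v) L × All (_∈ L) (neighbours v))
    lists? v L = DecUnique.unique? (≡-dec Fin._≟_ Fin._≟_) L ×-dec
      All.all? (Vertices._∈? neighbours v) L ×-dec All.all? (Vertices._∈? L) (neighbours v)

  valid⇒flat : ∀ {x y ms h} → Valid x y ms h → All (λ (z , w , k) → Walk z w k) ms →
               (∀ {u v} → u ∼ v → h v ℕ.≤ suc (h u)) → FlatEdge graph x y
  valid⇒flat {ms = ms} {h} (cost , four , lists-x , lists-y , rise , drop) walks lip = record
    { matched = ms ; walks = walks ; cost≡6 = cost ; four = four
    ; nbrsˡ = enumerates lists-x ; nbrsʳ = enumerates lists-y
    ; height = h ; lipschitz = lip ; rise = rise ; drop = drop
    }
    where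
    enumerates : ∀ {v L} → Unique L × All (_∈ neighbours v) L × All (_∈ L) (neighbours v) →
                 L enumerates (v ∼_)
    enumerates (u , s , c) = record
      { unique = u ; sound = All.map ∈⇒∼ s ; complete = λ a → All.lookup c (∼⇒∈ a) }

  lipschitz-from : (h : Vertex → ℕ) → (∀ v → h (T v) ℕ.≤ suc (h v)) → (∀ v → h v ℕ.≤ suc (h (T v))) →
                   (∀ p i → All (λ q → h (q , i) ℕ.≤ suc (h (p , i))) (nbr p)) →
                   ∀ {u v} → u ∼ v → h v ℕ.≤ suc (h u)
  lipschitz-from h rises falls along up            = rises _
  lipschitz-from h rises falls along {u} down      =
    subst (λ v → h (T⁻¹ u) ℕ.≤ suc (h v)) (T∘T⁻¹ u) (falls (T⁻¹ u))
  lipschitz-from h rises falls along (fibre {p} {i = i} e) = All.lookup (along p i) e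

  pattern far i = suc (suc (suc (suc (suc i))))

  -- The potentials for the edges from level 2 to levels 3 and 1: monotone on the levels 1, …, 4
  -- (resp. 3, …, 0) which carry the transport, and closed up around the rest of the cycle.
  up-height down-height : Level → ℕ
  up-height 0F = 1
  up-height 1F = 0
  up-height 2F = 1
  up-height 3F = 2
  up-height 4F = 3
  up-height 5F = 2
  up-height (suc (far _)) = 1
  down-height 0F = 3
  down-height 1F = 2
  down-height 2F = 1
  down-height 3F = 0
  down-height 4F = 1
  down-height (far _) = 2

  cross-lipschitz : (h : Level → ℕ) → (∀ i → h (next i) ℕ.≤ suc (h i)) → (∀ i → h i ℕ.≤ suc (h (next i))) →
                    ∀ {u v} → u ∼ v → h (proj₂ v) ℕ.≤ suc (h (proj₂ u))
  cross-lipschitz h rises falls = lipschitz-from (h ∘ proj₂) (rises ∘ proj₂) (falls ∘ proj₂)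
    (λ p i → universal (λ _ → ℕ.n≤1+n _) (nbr p))

  -- Whether a far level is the last one depends on `m`, so `next` does not compute there: it either
  -- wraps to 0 or goes on to a level that is at least 6.
  next-far : (P : Level → Set) → P 0F → (∀ j → P (suc (far j))) → ∀ i → P (next (far i))
  next-far P p₀ p₆ i with view i
  ... | ‵fromℕ     = p₀
  ... | ‵inject₁ j = p₆ j

  up-matched : Fin 10 → List (Vertex × Vertex × ℕ)
  up-matched p = (T⁻¹ (p , 2F) , T (T (p , 2F)) , 3) ∷ map (λ q → (q , 2F) , T (q , 2F) , 1) (nbr p)

  down-matched : Fin 10 → List (Vertex × Vertex × ℕ)
  down-matched p = (T (p , 2F) , T⁻¹ (T⁻¹ (p , 2F)) , 3) ∷ map (λ q → (q , 2F) , T⁻¹ (q , 2F) , 1) (nbr p)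

  -- Decided by evaluation although `m` is a variable: every vertex involved has a concrete level
  -- between 0 and 4, where `next`, `prev` and the comparisons reduce.
  up-valid : ∀ p → Valid (p , 2F) (T (p , 2F)) (up-matched p) (up-height ∘ proj₂)
  up-valid = from-yes (Fin.all? λ p →
    valid? (p , 2F) (T (p , 2F)) (up-matched p) (up-height ∘ proj₂))

  down-valid : ∀ p → Valid (p , 2F) (T⁻¹ (p , 2F)) (down-matched p) (down-height ∘ proj₂)
  down-valid = from-yes (Fin.all? λ p →
    valid? (p , 2F) (T⁻¹ (p , 2F)) (down-matched p) (down-height ∘ proj₂))

  up-flat : ∀ p → FlatEdge graph (p , 2F) (T (p , 2F))
  up-flat p = valid⇒flat (up-valid p)
    (_∷_ {P = λ (z , w , k) → Walk z w k} (long ∷ up ∷ up ∷ [])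
      (All.map⁺ (universal (λ _ → up ∷ []) (nbr p))))
    (cross-lipschitz up-height rises falls)
    where
    long : T⁻¹ (p , 2F) ∼ (p , 2F)
    long = subst (λ q → T⁻¹ (p , 2F) ∼ (q , 2F)) (φ-involutive p) up
    rises : ∀ i → up-height (next i) ℕ.≤ suc (up-height i)
    rises 0F = ℕ.z≤n
    rises 1F = ℕ.≤-refl
    rises 2F = ℕ.≤-refl
    rises 3F = ℕ.≤-refl
    rises 4F = ℕ.m≤m+n 2 2
    rises 5F = ℕ.m≤m+n 1 2
    rises (suc (far i)) = next-far (λ j → up-height j ℕ.≤ 2) (ℕ.n≤1+n 1) (λ _ → ℕ.n≤1+n 1) (suc i)
    falls : ∀ i → up-height i ℕ.≤ suc (up-height (next i))
    falls 0F = ℕ.≤-refl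
    falls 1F = ℕ.z≤n
    falls 2F = ℕ.m≤m+n 1 2
    falls 3F = ℕ.m≤m+n 2 2
    falls 4F = ℕ.≤-refl
    falls 5F = ℕ.≤-refl
    falls (suc (far i)) = next-far (λ j → 1 ℕ.≤ suc (up-height j)) (ℕ.n≤1+n 1) (λ _ → ℕ.n≤1+n 1) (suc i)

  down-flat : ∀ p → FlatEdge graph (p , 2F) (T⁻¹ (p , 2F))
  down-flat p = valid⇒flat (down-valid p)
    (_∷_ {P = λ (z , w , k) → Walk z w k} (long ∷ down ∷ down ∷ [])
      (All.map⁺ (universal (λ _ → down ∷ []) (nbr p))))
    (cross-lipschitz down-height rises falls)
    where
    long : T (p , 2F) ∼ (p , 2F)
    long = subst (λ q → T (p , 2F) ∼ (q , 2F)) (φ-involutive p) down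
    rises : ∀ i → down-height (next i) ℕ.≤ suc (down-height i)
    rises 0F = ℕ.m≤m+n 2 2
    rises 1F = ℕ.m≤m+n 1 2
    rises 2F = ℕ.z≤n
    rises 3F = ℕ.≤-refl
    rises 4F = ℕ.≤-refl
    rises (far i) = next-far (λ j → down-height j ℕ.≤ 3) ℕ.≤-refl (λ _ → ℕ.n≤1+n 2) i
    falls : ∀ i → down-height i ℕ.≤ suc (down-height (next i))
    falls 0F = ℕ.≤-refl
    falls 1F = ℕ.≤-refl
    falls 2F = ℕ.≤-refl
    falls 3F = ℕ.z≤n
    falls 4F = ℕ.m≤m+n 1 2
    falls (far i) = next-far (λ j → 2 ℕ.≤ suc (down-height j)) (ℕ.m≤m+n 2 2) (λ _ → ℕ.n≤1+n 2) i

  -- Since `T` identifies neighbouring fibres through `φ`, reading levels 1 and 3 through `φ` makes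
  -- the potential constant along `T` on the three levels that carry the transport.
  fibre-height : Fin 10 → Fin 10 → Vertex → ℕ
  fibre-height p q (r , 1F) = petersen-height p q (φ r)
  fibre-height p q (r , 2F) = petersen-height p q r
  fibre-height p q (r , 3F) = petersen-height p q (φ r)
  fibre-height p q (r , _)  = 1

  fibre-matched : Fin 10 → Fin 10 → List (Vertex × Vertex × ℕ)
  fibre-matched p q =
    (T (p , 2F) , T (q , 2F) , 1) ∷ (T⁻¹ (p , 2F) , T⁻¹ (q , 2F) , 1) ∷
    map (λ (r , s) → (r , 2F) , (s , 2F) , 2) (zip (others p q) (others q p))

  fibre-valid : ∀ p → All (λ q → Valid (p , 2F) (q , 2F) (fibre-matched p q) (fibre-height p q)) (nbr p)
  fibre-valid = from-yes (Fin.all? λ p → All.all? (λ q →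
    valid? (p , 2F) (q , 2F) (fibre-matched p q) (fibre-height p q)) (nbr p))

  fibre-flat : ∀ {p q} → q ∈ nbr p → FlatEdge graph (p , 2F) (q , 2F)
  fibre-flat {p} {q} e = valid⇒flat (All.lookup (fibre-valid p) e)
    (_∷_ {P = λ (z , w , k) → Walk z w k} (T-∼ edge ∷ []) ((T⁻¹-∼ edge ∷ []) ∷
      All.map⁺ (All.map through (All.lookup (others-joined p) e))))
    (lipschitz-from h rises falls along)
    where
    edge : (p , 2F) ∼ (q , 2F)
    edge = fibre e
    through : ∀ {(r , s) : Fin 10 × Fin 10} → Any (λ t → s ∈ nbr t) (nbr r) → Walk (r , 2F) (s , 2F) 2
    through any with _ , r∼t , t∼s ← find any = fibre r∼t ∷ fibre t∼s ∷ []
    g : Fin 10 → ℕ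
    g = petersen-height p q
    h : Vertex → ℕ
    h = fibre-height p q
    g≤2 : ∀ r → g r ℕ.≤ 2
    g≤2 = petersen-height≤2 p q
    rises : ∀ v → h (T v) ℕ.≤ suc (h v)
    -- At the two cuts, between levels 0 and 1 and between 3 and 4, the constant 1 meets values from
    -- 0 to 2, a jump of at most 1.
    rises (r , 0F) = g≤2 (φ (φ r))
    rises (r , 1F) = ℕ.n≤1+n _
    rises (r , 2F) = ℕ.m≤n⇒m≤1+n (ℕ.≤-reflexive (cong g (φ-involutive r)))
    rises (r , 3F) = ℕ.s≤s ℕ.z≤n
    rises (r , 4F) = ℕ.s≤s ℕ.z≤n
    rises (r , far i) = next-far (λ j → h (φ r , j) ℕ.≤ 2) (ℕ.n≤1+n 1) (λ _ → ℕ.n≤1+n 1) i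
    falls : ∀ v → h v ℕ.≤ suc (h (T v))
    falls (r , 0F) = ℕ.s≤s ℕ.z≤n
    falls (r , 1F) = ℕ.n≤1+n _
    falls (r , 2F) = ℕ.m≤n⇒m≤1+n (ℕ.≤-reflexive (cong g (sym (φ-involutive r))))
    falls (r , 3F) = g≤2 (φ r)
    falls (r , 4F) = ℕ.s≤s ℕ.z≤n
    falls (r , far i) = ℕ.s≤s ℕ.z≤n
    g-lipschitz : ∀ r → All (λ s → g s ℕ.≤ suc (g r)) (nbr r)
    g-lipschitz = All.lookup (petersen-lipschitz p) e
    along : ∀ r i → All (λ s → h (s , i) ℕ.≤ suc (h (r , i))) (nbr r)
    along r 0F = universal (λ _ → ℕ.n≤1+n _) (nbr r)
    along r 1F = All.map (All.lookup (g-lipschitz (φ r))) (nbr-φ r)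
    along r 2F = g-lipschitz r
    along r 3F = All.map (All.lookup (g-lipschitz (φ r))) (nbr-φ r)
    along r 4F = universal (λ _ → ℕ.n≤1+n _) (nbr r)
    along r (far _) = universal (λ _ → ℕ.n≤1+n _) (nbr r)

  -- Spreading flatness from level 2 to all levels

  FlatAt : Vertex → Set
  FlatAt u = ∀ {v} → u ∼ v → FlatEdge graph u v

  flat-T : ∀ {u} → FlatAt u → FlatAt (T u)
  flat-T = transport-all T T⁻¹ T∘T⁻¹ T⁻¹∘T T-∼ T⁻¹-∼

  flat-T⁻¹ : ∀ {u} → FlatAt u → FlatAt (T⁻¹ u)
  flat-T⁻¹ = transport-all T⁻¹ T T⁻¹∘T T∘T⁻¹ T⁻¹-∼ T-∼

  flat-everywhere : ∀ i p → FlatAt (p , i)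
  flat-everywhere = next-induction (λ i → ∀ p → FlatAt (p , i))
    -- The induction starts at level 0, two steps of `T⁻¹` below the certified level.
    (pred {1F} (pred {2F} at-2))
    (λ i at p → subst (λ q → FlatAt (q , next i)) (φ-involutive p) (flat-T (at (φ p))))
    where
    pred : ∀ {i : Level} → (∀ p → FlatAt (p , i)) → ∀ p → FlatAt (p , prev i)
    pred {i} at p = subst (λ q → FlatAt (q , prev i)) (φ-involutive p) (flat-T⁻¹ (at (φ p)))
    at-2 : ∀ p → FlatAt (p , 2F)
    at-2 p up        = up-flat p
    at-2 p down      = down-flat p
    at-2 p (fibre e) = fibre-flat e

  ricci-flat : RicciFlat graph connected
  ricci-flat (p , i) _ a = flat graph connected (flat-everywhere i p a)

  -- The orbit through the seam

  module _ (φ^[8+m]0≡0 : fold 0F φ (8 ℕ.+ m) ≡ 0F) where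

    twisted : Twisted graph
    twisted = record
      { T = T ; T⁻¹ = T⁻¹ ; T⁻¹∘T = T⁻¹∘T ; Fibre = Fibre
      ; adj-T = λ _ → up ; adj-T⁻¹ = λ _ → down ; adj-fibre = λ { (fib e) → fibre e }
      ; adj-cases = ∼-cases ; only-common-T = only-common-T ; only-common-fibre = only-common-fibre
      ; base = 0F , zero ; twist = 1F , zero ; base∼twist = fib (here refl)
      ; orbit = orbit
      }
      where
      orbit : (P : Vertex → Set) → (∀ {v} → P v → P (T v)) → P (0F , zero) → P (1F , zero)
      -- After `8 + m` steps the orbit is on the last level with label 0; one further step wraps to
      -- level 0 and applies `φ` once more, which gives label 1.
      orbit P step p₀ = subst P (cong₂ _,_ (cong φ φ^[8+m]0≡0) (next-fromℕ (8 ℕ.+ m)))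
        (step (subst (λ k → P (fold 0F φ k , Fin.fromℕ (8 ℕ.+ m))) (Fin.toℕ-fromℕ (8 ℕ.+ m))
          (along (Fin.fromℕ (8 ℕ.+ m)))))
        where
        along : ∀ j → P (fold 0F φ (toℕ j) , j)
        along = <-weakInduction (λ j → P (fold 0F φ (toℕ j) , j)) p₀ λ j p →
          subst P (cong₂ _,_ (cong (λ k → φ (fold 0F φ k)) (Fin.toℕ-inject₁ j)) (next-inject₁ j)) (step p)

-- The infinite family

fold-φ-even : ∀ k → fold 0F φ (k ℕ.* 2) ≡ 0F
fold-φ-even zero    = refl
fold-φ-even (suc k) = trans (φ-involutive _) (fold-φ-even k)

≅⇒order≡ : ∀ {G H} → G ≅ H → Graph.order G ≡ Graph.order H
≅⇒order≡ {G} {H} ψ = ↔⇒≡ (↔-trans (↔-sym (Graph.finite G)) (↔-trans (_≅_.bijection ψ) (Graph.finite H)))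

theorem1p2 : Σ (ℕ → Graph) λ G →
    (∀ i → Σ (Graph.Connected (G i)) λ conn →
    Regular 5 (G i)
    × RicciFlat (G i) conn
    × (∀ H → IsRF⁵₇₂ H → ¬ (G i ≅ H))
    × ¬ CartesianProductType (G i))
    × (∀ i j → i ≢ j → ¬ (G i ≅ G j))
theorem1p2 =
  -- An even `m` makes the length `9 + m` odd, and `8 + m` is then `(4 + i) * 2`, an even number of
  -- applications of `φ`.
  (λ i → Bundle.graph (i ℕ.* 2)) ,
  (λ i → let open Bundle (i ℕ.* 2) in
    connected , regular , ricci-flat ,
    -- Orders settle both isomorphism claims: 10(9 + 2i) is at least 90, so never 72, and it
    -- determines i.
    (λ H rf ψ → ℕ.<⇒≢ (ℕ.≤-trans (ℕ.m≤m+n 73 17) (ℕ.*-monoʳ-≤ 10 (ℕ.m≤m+n 9 (i ℕ.* 2))))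
      (sym (trans (≅⇒order≡ ψ) (IsRF⁵₇₂.order≡72 rf)))) ,
    twisted⇒¬product (twisted (fold-φ-even (4 ℕ.+ i))) connected) ,
  λ i j i≢j ψ → i≢j (ℕ.*-cancelʳ-≡ i j 2 (ℕ.+-cancelˡ-≡ 9 _ _ (ℕ.*-cancelˡ-≡ _ _ 10 (≅⇒order≡ ψ))))
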